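{- Let $s,t$ be integers with $0<t<s$. There exists $n_0=n_0(s,t)$ such that the following holds for every $n\ge n_0$. For integers $a\ge 0$ put $\alpha_n(a):=s-t-a^2-\mathbb{1}_{\{n \text{ odd}\}}\,a$ and let $I_n=\{a\in\mathbb{Z}_{\ge 0}:\alpha_n(a)\ge 0\}$. Define \[ T_3(G_1):=\min_{a\in I_n}\Big[(s-1)\big(\lfloor n/2\rfloor-a\big)+\big(\lceil n/2\rceil+a\big)-2\alpha_n(a)\Big],\qquad T_3(G_2):=\min_{a\in I_n}\Big[s\big(\lfloor n/2\rfloor-a\big)-\alpha_n(a)\Big]. \] If $G$ is a graph on $n$ vertices with $\lfloor n^2/4\rfloor+t$ edges and triangle covering number $\tau_3(G)\ge s$, then $G$ contains at least $\min\{T_3(G_1),T_3(G_2)\}$ triangles.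
   Context: A triangle covering set of a graph $G$ is a set of vertices meeting every triangle of $G$; the triangle covering number $\tau_3(G)$ is the minimum size of such a set. $\mathbb{1}_{\{n\text{ odd}\}}$ equals $1$ if $n$ is odd and $0$ otherwise. (The two quantities are the triangle counts of the following constructions, with $a\in I_n$ chosen optimally. $G_1$: take $K_{|A|,|B|}$ with $|A|=\lceil n/2\rceil+a$, $|B|=\lfloor n/2\rfloor-a$; add $s-1$ disjoint edges $x_1y_1,\dots,x_{s-1}y_{s-1}$ inside $A$ and one edge $u_1u_2$ inside $B$; delete the edges $u_1x_1,\dots,u_1x_{\alpha_n(a)}$. $G_2$: same bipartition, add $s$ disjoint edges $x_1y_1,\dots,x_sy_s$ inside $A$, pick $u\in B$ and delete $ux_1,\dots,ux_{\alpha_n(a)}$. Both have $\lfloor n^2/4\rfloor+t$ edges and triangle covering number $s$.) -}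

module Defs where

open import Data.Bool using (Bool; true; false; _∧_; if_then_else_)
open import Data.Nat as ℕ using (ℕ; zero; suc; _<ᵇ_)
open import Data.Nat.DivMod using (_/_)
open import Data.Fin using (Fin; toℕ)
open import Data.Fin.Subset using (Subset; _∈_; ∣_∣)
open import Data.List using (List; map; filter; upTo; foldr; allFin)
open import Data.Nat.ListAction using (sum)
open import Data.Integer as Z using (ℤ; +_; _-_; _*_; _⊓_; _≤?_)
open import Data.Sum using (_⊎_)
open import Relation.Binary.PropositionalEquality using (_≡_)

record Graph (n : ℕ) : Set where
  field
    Adj    : Fin n → Fin n → Bool
    sym    : ∀ i j → Adj i j ≡ Adj j i
    irrefl : ∀ i → Adj i i ≡ false
open Graph public

ind : Bool → ℕ
ind b = if b then 1 else 0

edgeCount : ∀ {n} → Graph n → ℕ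
edgeCount {n} G =
  sum (map (λ i → sum (map (λ j → ind ((toℕ i <ᵇ toℕ j) ∧ Adj G i j)) (allFin n))) (allFin n))

triangleCount : ∀ {n} → Graph n → ℕ
triangleCount {n} G =
  sum (map (λ i → sum (map (λ j → sum (map (λ k →
    ind ((toℕ i <ᵇ toℕ j) ∧ (toℕ j <ᵇ toℕ k) ∧ Adj G i j ∧ Adj G j k ∧ Adj G i k))
    (allFin n))) (allFin n))) (allFin n))

IsTriangle : ∀ {n} → Graph n → Fin n → Fin n → Fin n → Set
IsTriangle G i j k = (Adj G i j ≡ true) Data.Product.× ((Adj G j k ≡ true) Data.Product.× (Adj G i k ≡ true))
  where import Data.Product

IsTriangleCover : ∀ {n} → Graph n → Subset n → Set
IsTriangleCover G S = ∀ i j k → IsTriangle G i j k → i ∈ S ⊎ (j ∈ S ⊎ k ∈ S)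

TriangleCoverNumberAtLeast : ∀ {n} → Graph n → ℕ → Set
TriangleCoverNumberAtLeast G s = ∀ S → IsTriangleCover G S → s ℕ.≤ ∣ S ∣

oddInd : ℕ → ℤ
oddInd zero = + 0
oddInd (suc zero) = + 1
oddInd (suc (suc n)) = oddInd n

α : ℕ → ℕ → ℕ → ℕ → ℤ
α s t n a = (+ s - + t) - (+ a * + a) - oddInd n * + a

floor2 ceil2 : ℕ → ℤ
floor2 n = + (n / 2)
ceil2 n = + (suc n / 2)

-- I_n ∩ candidates: every a ∈ I_n satisfies a ≤ a² ≤ s - t, so I_n ⊆ {0,…,s-t}
Iₙ : ℕ → ℕ → ℕ → List ℕ
Iₙ s t n = filter (λ a → + 0 ≤? α s t n a) (upTo (suc (s ℕ.∸ t)))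

-- minimum of f over I_n (a = 0 lies in I_n when t < s, so f 0 is a valid seed)
minOverI : ℕ → ℕ → ℕ → (ℕ → ℤ) → ℤ
minOverI s t n f = foldr _⊓_ (f 0) (map f (Iₙ s t n))

T₃G₁ : ℕ → ℕ → ℕ → ℤ
T₃G₁ s t n = minOverI s t n (λ a →
  ((+ s - + 1) * (floor2 n - + a) Z.+ (ceil2 n Z.+ + a)) - + 2 * α s t n a)

T₃G₂ : ℕ → ℕ → ℕ → ℤ
T₃G₂ s t n = minOverI s t n (λ a → + s * (floor2 n - + a) - α s t n a)

{-# OPTIONS --safe #-}
module Submission where

-- Write T for the number of triangles and e for the number of edges. If T ≥ s⌊n/2⌋,
-- compare with G₂ at a = 0. Otherwise T = O(n), and double counting (edge, vertex) pairs
-- gives 2en + 6T = 2 Σ d(v)² + Z, where Z counts ordered edges ij together with a common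
-- non-neighbour; since Σ (2d(v) − n)² ≥ 0 and 4e ≥ n², it follows that Z ≤ 6T.
-- Averaging over the edges ij then yields one with no common neighbour and no common
-- non-neighbour, and with O(1) triangles through i or j: its neighbourhoods split the
-- vertex set into parts of sizes a ≥ b that span only m = O(1) inner edges.
-- If M cross pairs are missing and b = ⌊n/2⌋ − x, counting edges gives
-- m = t + M + x² + 1_{n odd} x. Each inner edge lies in about n/2 triangles, so m ≤ s for
-- large n. Picking endpoints of inner edges gives triangle covers, so the covering number
-- forces m ≥ s and, once m = s, that the inner edges form a matching; hence M = α_n(x).
-- A missing pair then destroys at most one triangle if all inner edges are on one side,
-- which gives the bound of G₂, and at most two otherwise, which gives that of G₁.

open import Defs
open import Data.Bool using (Bool; true; false; not; _∧_; _xor_) renaming (T to IsTrue)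
open import Data.Bool.Properties using (not-involutive)
open import Data.Fin using (Fin; toℕ; zero; suc)
open import Data.Fin.Properties using (toℕ-injective) renaming (_≟_ to _≟ꟳ_)
open import Data.Fin.Subset using (Subset; ∣_∣) renaming (_∈_ to _∈ˢ_)
import Data.Integer as ℤ
import Data.Integer.Properties as ℤ
import Data.Integer.Tactic.RingSolver as ℤ-Solver
open import Data.List using (List; []; _∷_; map; foldr; allFin; length)
open import Data.List.Membership.Propositional using (_∈_)
open import Data.List.Membership.Propositional.Properties using (∈-allFin; ∈-upTo⁺; ∈-filter⁺)
open import Data.List.Properties using (length-tabulate; map-tabulate)
open import Data.List.Relation.Unary.Any using (here; there)
open import Data.Nat using (ℕ; zero; suc; _<_; _≤_; _*_; _+_; _∸_; _<ᵇ_; _<?_; z≤n; s≤s)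
open import Data.Nat.DivMod using (_/_; m*n/n≡m; +-distrib-/-∣ʳ)
open import Data.Nat.Divisibility using (divides)
open import Data.Nat.ListAction using (sum)
open import Data.Nat.Properties
open import Data.Nat.Tactic.RingSolver using (solve-∀)
open import Data.Product using (∃; ∃₂; _×_; _,_)
open import Data.Sum using (_⊎_; inj₁; inj₂)
open import Data.Vec using (tabulate)
open import Data.Vec.Properties using (lookup⇒[]=; lookup∘tabulate)
open import Function using (_∘_; id)
open import Relation.Binary.Definitions using (tri<; tri≈; tri>)
open import Relation.Binary.PropositionalEquality using (_≡_; refl; cong; cong₂; trans; subst; subst₂; module ≡-Reasoning) renaming (sym to ≡-sym)
open import Relation.Nullary using (yes; no; contradiction)
open import Relation.Nullary.Decidable using (⌊_⌋)

-- Finite sums over lists and over vertices.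

module _ {A : Set} where

  sumOver : List A → (A → ℕ) → ℕ
  sumOver xs f = sum (map f xs)

  sumOver-mono : ∀ xs {f g : A → ℕ} → (∀ x → f x ≤ g x) → sumOver xs f ≤ sumOver xs g
  sumOver-mono []       f≤g = z≤n
  sumOver-mono (x ∷ xs) f≤g = +-mono-≤ (f≤g x) (sumOver-mono xs f≤g)

  sumOver-+ : ∀ xs (f g : A → ℕ) → sumOver xs (λ x → f x + g x) ≡ sumOver xs f + sumOver xs g
  sumOver-+ []       f g = refl
  sumOver-+ (x ∷ xs) f g = trans (cong (λ y → f x + g x + y) (sumOver-+ xs f g))
                                 (interchange (f x) (g x) _ _)
    where
    interchange : ∀ a b c d → a + b + (c + d) ≡ a + c + (b + d)
    interchange = solve-∀

  sumOver-*ˡ : ∀ xs c (f : A → ℕ) → sumOver xs (λ x → c * f x) ≡ c * sumOver xs f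
  sumOver-*ˡ []       c f = ≡-sym (*-zeroʳ c)
  sumOver-*ˡ (x ∷ xs) c f = trans (cong (c * f x +_) (sumOver-*ˡ xs c f)) (≡-sym (*-distribˡ-+ c (f x) _))

  sumOver-const : ∀ xs c → sumOver xs (λ _ → c) ≡ c * length xs
  sumOver-const []       c = ≡-sym (*-zeroʳ c)
  sumOver-const (x ∷ xs) c = trans (cong (c +_) (sumOver-const xs c)) (≡-sym (*-suc c _))

  ≤-sumOver : ∀ {xs x} (f : A → ℕ) → x ∈ xs → f x ≤ sumOver xs f
  ≤-sumOver f (here refl)  = m≤m+n _ _
  ≤-sumOver f (there x∈xs) = ≤-trans (≤-sumOver f x∈xs) (m≤n+m _ _)

  sumOver-< : ∀ xs {f g : A → ℕ} → sumOver xs f < sumOver xs g → ∃ λ x → f x < g x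
  sumOver-< (x ∷ xs) {f} {g} lt with f x <? g x
  ... | yes fx<gx = x , fx<gx
  ... | no  fx≮gx = sumOver-< xs (+-cancelˡ-< (g x) _ _ (≤-<-trans (+-monoˡ-≤ _ (≮⇒≥ fx≮gx)) lt))

sumOver-comm : ∀ {A B : Set} xs ys (f : A → B → ℕ) →
  sumOver xs (λ x → sumOver ys (f x)) ≡ sumOver ys (λ y → sumOver xs (λ x → f x y))
sumOver-comm []       ys f = ≡-sym (sumOver-const ys 0)
sumOver-comm (x ∷ xs) ys f =
  trans (cong (sumOver ys (f x) +_) (sumOver-comm xs ys f)) (≡-sym (sumOver-+ ys (f x) _))

-- Opaque, so that unification recovers summands and never unfolds a sum.
opaque
  ∑ : ∀ {n} → (Fin n → ℕ) → ℕ
  ∑ {n} = sumOver (allFin n)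

  ∑-mono : ∀ {n} {f g : Fin n → ℕ} → (∀ i → f i ≤ g i) → ∑ f ≤ ∑ g
  ∑-mono {n} = sumOver-mono (allFin n)

  ∑-+ : ∀ {n} (f g : Fin n → ℕ) → ∑ (λ i → f i + g i) ≡ ∑ f + ∑ g
  ∑-+ {n} = sumOver-+ (allFin n)

  ∑-*ˡ : ∀ {n} c (f : Fin n → ℕ) → ∑ (λ i → c * f i) ≡ c * ∑ f
  ∑-*ˡ {n} = sumOver-*ˡ (allFin n)

  ∑-const : ∀ {n} c → ∑ {n} (λ _ → c) ≡ c * n
  ∑-const {n} c = trans (sumOver-const (allFin n) c) (cong (c *_) (length-tabulate id))

  ≤-∑ : ∀ {n} (f : Fin n → ℕ) → ∀ i → f i ≤ ∑ f
  ≤-∑ f i = ≤-sumOver f (∈-allFin i)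

  ∑-< : ∀ {n} {f g : Fin n → ℕ} → ∑ f < ∑ g → ∃ λ i → f i < g i
  ∑-< {n} = sumOver-< (allFin n)

  ∑-comm : ∀ {n} (f : Fin n → Fin n → ℕ) → ∑ (λ i → ∑ (f i)) ≡ ∑ (λ j → ∑ (λ i → f i j))
  ∑-comm {n} = sumOver-comm (allFin n) (allFin n)

  ∑-suc : ∀ {n} (f : Fin (suc n) → ℕ) → ∑ f ≡ f zero + ∑ (f ∘ suc)
  ∑-suc f = cong (λ xs → f zero + sum xs) (trans (map-tabulate suc f) (≡-sym (map-tabulate id (f ∘ suc))))

-- Double and triple sums, and their symmetrisation.

module _ {n : ℕ} where

  ∑-cong : {f g : Fin n → ℕ} → (∀ i → f i ≡ g i) → ∑ f ≡ ∑ g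
  ∑-cong f≡g = ≤-antisym (∑-mono (≤-reflexive ∘ f≡g)) (∑-mono (≤-reflexive ∘ ≡-sym ∘ f≡g))

  ∑-*ʳ : ∀ c (f : Fin n → ℕ) → ∑ (λ i → f i * c) ≡ ∑ f * c
  ∑-*ʳ c f = trans (∑-cong (λ i → *-comm (f i) c)) (trans (∑-*ˡ c f) (*-comm c (∑ f)))

  ∑-** : ∀ (f g : Fin n → ℕ) → ∑ (λ i → ∑ (λ j → f i * g j)) ≡ ∑ f * ∑ g
  ∑-** f g = trans (∑-cong (λ i → ∑-*ˡ (f i) g)) (∑-*ʳ (∑ g) f)

  ∑² : (Fin n → Fin n → ℕ) → ℕ
  ∑² f = ∑ (λ i → ∑ (f i))

  opaque
    unfolding ∑

    ∑²-def : ∀ f → ∑² f ≡ sum (map (λ i → sum (map (f i) (allFin n))) (allFin n))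
    ∑²-def f = refl

  ∑²-mono : {f g : Fin n → Fin n → ℕ} → (∀ i j → f i j ≤ g i j) → ∑² f ≤ ∑² g
  ∑²-mono f≤g = ∑-mono (λ i → ∑-mono (f≤g i))

  ∑²-cong : {f g : Fin n → Fin n → ℕ} → (∀ i j → f i j ≡ g i j) → ∑² f ≡ ∑² g
  ∑²-cong f≡g = ∑-cong (λ i → ∑-cong (f≡g i))

  ∑²-+ : (f g : Fin n → Fin n → ℕ) → ∑² (λ i j → f i j + g i j) ≡ ∑² f + ∑² g
  ∑²-+ f g = trans (∑-cong (λ i → ∑-+ (f i) (g i))) (∑-+ _ _)

  ∑²-*ˡ : ∀ c (f : Fin n → Fin n → ℕ) → ∑² (λ i j → c * f i j) ≡ c * ∑² f
  ∑²-*ˡ c f = trans (∑-cong (λ i → ∑-*ˡ c (f i))) (∑-*ˡ c _)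

  ∑²-*ʳ : ∀ c (f : Fin n → Fin n → ℕ) → ∑² (λ i j → f i j * c) ≡ ∑² f * c
  ∑²-*ʳ c f = trans (∑-cong (λ i → ∑-*ʳ c (f i))) (∑-*ʳ c _)

  ∑²-< : {f g : Fin n → Fin n → ℕ} → ∑² f < ∑² g → ∃₂ λ i j → f i j < g i j
  ∑²-< lt with i , lt′ ← ∑-< lt = i , ∑-< lt′

  ∑³ : (Fin n → Fin n → Fin n → ℕ) → ℕ
  ∑³ f = ∑ (λ i → ∑² (f i))

  opaque
    unfolding ∑

    ∑³-def : ∀ f → ∑³ f ≡ sum (map (λ i → sum (map (λ j → sum (map (f i j) (allFin n))) (allFin n))) (allFin n))
    ∑³-def f = refl

  ∑³-mono : {f g : Fin n → Fin n → Fin n → ℕ} → (∀ i j k → f i j k ≤ g i j k) → ∑³ f ≤ ∑³ g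
  ∑³-mono f≤g = ∑-mono (λ i → ∑²-mono (f≤g i))

  ∑³-cong : {f g : Fin n → Fin n → Fin n → ℕ} → (∀ i j k → f i j k ≡ g i j k) → ∑³ f ≡ ∑³ g
  ∑³-cong f≡g = ∑-cong (λ i → ∑²-cong (f≡g i))

  ∑³-+ : (f g : Fin n → Fin n → Fin n → ℕ) → ∑³ (λ i j k → f i j k + g i j k) ≡ ∑³ f + ∑³ g
  ∑³-+ f g = trans (∑-cong (λ i → ∑²-+ (f i) (g i))) (∑-+ _ _)

  ∑³-swap₁₂ : (f : Fin n → Fin n → Fin n → ℕ) → ∑³ (λ i j k → f j i k) ≡ ∑³ f
  ∑³-swap₁₂ f = ≡-sym (∑-comm (λ i j → ∑ (f i j)))

  ∑³-swap₂₃ : (f : Fin n → Fin n → Fin n → ℕ) → ∑³ (λ i j k → f i k j) ≡ ∑³ f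
  ∑³-swap₂₃ f = ∑-cong (λ i → ≡-sym (∑-comm (f i)))

  symm : (Fin n → Fin n → Fin n → ℕ) → Fin n → Fin n → Fin n → ℕ
  symm f i j k = f i j k + f i k j + (f j i k + f j k i) + (f k i j + f k j i)

  -- Renaming the summation variables carries each of the six summands to `f`. Counts that fix an
  -- order on the vertices can then be compared term by term with sums over all ordered triples.
  ∑³-symm : ∀ f → ∑³ (symm f) ≡ 6 * ∑³ f
  ∑³-symm f = begin
    ∑³ (symm f)
      ≡⟨ ∑³-+ _ _ ⟩
    ∑³ (λ i j k → f i j k + f i k j + (f j i k + f j k i)) + ∑³ (λ i j k → f k i j + f k j i)
      ≡⟨ cong₂ _+_ (∑³-+ _ _) (∑³-+ _ _) ⟩
    ∑³ (λ i j k → f i j k + f i k j) + ∑³ (λ i j k → f j i k + f j k i) +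
      (∑³ (λ i j k → f k i j) + ∑³ (λ i j k → f k j i))
      ≡⟨ cong₂ (λ a b → a + b + (∑³ (λ i j k → f k i j) + ∑³ (λ i j k → f k j i))) (∑³-+ _ _) (∑³-+ _ _) ⟩
    ∑³ f + ∑³ (λ i j k → f i k j) + (∑³ (λ i j k → f j i k) + ∑³ (λ i j k → f j k i)) +
      (∑³ (λ i j k → f k i j) + ∑³ (λ i j k → f k j i))
      ≡⟨ cong₂ _+_ (cong₂ _+_ (cong (∑³ f +_) e₂) (cong₂ _+_ (∑³-swap₁₂ f) e₄)) (cong₂ _+_ e₅ e₆) ⟩
    ∑³ f + ∑³ f + (∑³ f + ∑³ f) + (∑³ f + ∑³ f)
      ≡⟨ six (∑³ f) ⟩
    6 * ∑³ f ∎
    where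
    open ≡-Reasoning
    e₂ : ∑³ (λ i j k → f i k j) ≡ ∑³ f
    e₂ = ∑³-swap₂₃ f
    e₄ : ∑³ (λ i j k → f j k i) ≡ ∑³ f
    e₄ = trans (∑³-swap₁₂ (λ i j k → f i k j)) e₂
    e₅ : ∑³ (λ i j k → f k i j) ≡ ∑³ f
    e₅ = trans (∑³-swap₂₃ (λ i j k → f j i k)) (∑³-swap₁₂ f)
    e₆ : ∑³ (λ i j k → f k j i) ≡ ∑³ f
    e₆ = trans (∑³-swap₂₃ (λ i j k → f j k i)) e₄
    six : ∀ x → x + x + (x + x) + (x + x) ≡ 6 * x
    six = solve-∀

  _≺_ : Fin n → Fin n → Bool
  i ≺ j = toℕ i <ᵇ toℕ j

  ≺-split : ∀ i j → (i ≺ j ≡ true × j ≺ i ≡ false) ⊎ (i ≡ j ⊎ (i ≺ j ≡ false × j ≺ i ≡ true))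
  ≺-split i j with <-cmp (toℕ i) (toℕ j) | toℕ i <ᵇ toℕ j in p | toℕ j <ᵇ toℕ i in q
  ... | tri≈ _ e _  | _ | _ = inj₂ (inj₁ (toℕ-injective e))
  ... | tri< _ _ _  | true  | false = inj₁ (refl , refl)
  ... | tri> _ _ _  | false | true  = inj₂ (inj₂ (refl , refl))
  ... | tri< lt _ _ | false | _    = contradiction (<⇒<ᵇ lt) (λ t → subst IsTrue p t)
  ... | tri< _ _ gt | true  | true = contradiction (<ᵇ⇒< _ _ (subst IsTrue (≡-sym q) _)) gt
  ... | tri> _ _ gt | _ | false = contradiction (<⇒<ᵇ gt) (λ t → subst IsTrue q t)
  ... | tri> lt _ _ | true | true = contradiction (<ᵇ⇒< _ _ (subst IsTrue (≡-sym p) _)) lt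

  -- The passage from ordered to unordered pairs: off the diagonal exactly one of the two orders
  -- survives the indicator, and the diagonal vanishes.
  ∑²-≺ : (f : Fin n → Fin n → ℕ) → (∀ i j → f i j ≡ f j i) → (∀ i → f i i ≡ 0) →
         ∑² f ≡ 2 * ∑² (λ i j → ind (i ≺ j) * f i j)
  ∑²-≺ f f-sym f-irr = begin
    ∑² f                                                      ≡⟨ ∑²-cong split ⟩
    ∑² (λ i j → g i j + g j i)                                ≡⟨ ∑²-+ g _ ⟩
    ∑² g + ∑² (λ i j → g j i)                                 ≡⟨ cong (∑² g +_) (≡-sym (∑-comm g)) ⟩
    ∑² g + ∑² g                                               ≡⟨ cong (∑² g +_) (≡-sym (+-identityʳ _)) ⟩
    2 * ∑² g                                                  ∎
    where
    open ≡-Reasoning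
    g : Fin n → Fin n → ℕ
    g i j = ind (i ≺ j) * f i j
    split : ∀ i j → f i j ≡ g i j + g j i
    split i j with ≺-split i j
    ... | inj₁ (p , q) rewrite p | q = ≡-sym (trans (+-identityʳ _) (+-identityʳ _))
    ... | inj₂ (inj₂ (p , q)) rewrite p | q = trans (f-sym i j) (≡-sym (+-identityʳ _))
    ... | inj₂ (inj₁ refl) rewrite f-irr i | *-zeroʳ (ind (i ≺ i)) = refl

ind-∧ : ∀ x y → ind (x ∧ y) ≡ ind x * ind y
ind-∧ true  y = ≡-sym (+-identityʳ (ind y))
ind-∧ false y = refl

ind*≤ : ∀ x m → ind x * m ≤ m
ind*≤ true  m = ≤-reflexive (+-identityʳ m)
ind*≤ false m = z≤n

2xy≤xx+yy : ∀ x y → 2 * (x * y) ≤ x * x + y * y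
2xy≤xx+yy x y with ≤-total x y
... | inj₁ x≤y with r , refl ← m≤n⇒∃[o]m+o≡n x≤y = subst (2 * (x * (x + r)) ≤_) (square x r) (m≤m+n _ (r * r))
  where
  square : ∀ x r → 2 * (x * (x + r)) + r * r ≡ x * x + (x + r) * (x + r)
  square = solve-∀
... | inj₂ y≤x with r , refl ← m≤n⇒∃[o]m+o≡n y≤x = subst (2 * ((y + r) * y) ≤_) (square y r) (m≤m+n _ (r * r))
  where
  square : ∀ y r → 2 * ((y + r) * y) + r * r ≡ (y + r) * (y + r) + y * y
  square = solve-∀

-- Double counting of edges and triangles, and an edge of small defect.

module Counting {n : ℕ} (G : Graph n) where

  A N : Fin n → Fin n → ℕ
  A i j = ind (Adj G i j)
  N i j = ind (not (Adj G i j))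

  A-sym : ∀ i j → A i j ≡ A j i
  A-sym i j = cong ind (sym G i j)

  N-sym : ∀ i j → N i j ≡ N j i
  N-sym i j = cong (ind ∘ not) (sym G i j)

  tri : Fin n → Fin n → Fin n → ℕ
  tri i j k = A i j * A j k * A i k

  d : Fin n → ℕ
  d i = ∑ (A i)

  ∑²A≡2e : ∑² A ≡ 2 * edgeCount G
  ∑²A≡2e = trans (∑²-≺ A A-sym (λ i → cong ind (irrefl G i)))
                 (cong (2 *_) (trans (∑²-cong (λ i j → ≡-sym (ind-∧ (i ≺ j) (Adj G i j)))) (∑²-def _)))

  -- Every tournament on three vertices contains a directed path on all of them.
  ∑³tri≤6T : ∑³ tri ≤ 6 * triangleCount G
  ∑³tri≤6T = ≤-trans (∑³-mono tri≤symm) (≤-reflexive (trans (∑³-symm g) (cong (6 *_) (∑³-def g))))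
    where
    g : Fin n → Fin n → Fin n → ℕ
    g i j k = ind ((i ≺ j) ∧ (j ≺ k) ∧ Adj G i j ∧ Adj G j k ∧ Adj G i k)
    tri≤symm : ∀ i j k → tri i j k ≤ symm g i j k
    tri≤symm i j k with Adj G i j in p | Adj G j k in q | Adj G i k in r
    ... | false | _     | _     = z≤n
    ... | true  | false | _     = z≤n
    ... | true  | true  | false = z≤n
    ... | true  | true  | true
      rewrite trans (sym G j i) p | trans (sym G k j) q | trans (sym G k i) r
      with ≺-split i j | ≺-split j k | ≺-split i k
    ... | inj₂ (inj₁ refl) | _ | _ = contradiction (trans (≡-sym p) (irrefl G i)) λ ()
    ... | inj₁ _ | inj₂ (inj₁ refl) | _ = contradiction (trans (≡-sym q) (irrefl G j)) λ ()
    ... | inj₂ (inj₂ _) | inj₂ (inj₁ refl) | _ = contradiction (trans (≡-sym q) (irrefl G j)) λ ()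
    ... | inj₁ _ | inj₁ _ | inj₂ (inj₁ refl) = contradiction (trans (≡-sym r) (irrefl G i)) λ ()
    ... | inj₁ _ | inj₂ (inj₂ _) | inj₂ (inj₁ refl) = contradiction (trans (≡-sym r) (irrefl G i)) λ ()
    ... | inj₂ (inj₂ _) | inj₁ _ | inj₂ (inj₁ refl) = contradiction (trans (≡-sym r) (irrefl G i)) λ ()
    ... | inj₂ (inj₂ _) | inj₂ (inj₂ _) | inj₂ (inj₁ refl) = contradiction (trans (≡-sym r) (irrefl G i)) λ ()
    ... | inj₁ (a , a′) | inj₁ (b , b′) | inj₁ (c , c′) rewrite a | a′ | b | b′ | c | c′ = s≤s z≤n
    ... | inj₁ (a , a′) | inj₁ (b , b′) | inj₂ (inj₂ (c , c′)) rewrite a | a′ | b | b′ | c | c′ = s≤s z≤n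
    ... | inj₁ (a , a′) | inj₂ (inj₂ (b , b′)) | inj₁ (c , c′) rewrite a | a′ | b | b′ | c | c′ = s≤s z≤n
    ... | inj₁ (a , a′) | inj₂ (inj₂ (b , b′)) | inj₂ (inj₂ (c , c′)) rewrite a | a′ | b | b′ | c | c′ = s≤s z≤n
    ... | inj₂ (inj₂ (a , a′)) | inj₁ (b , b′) | inj₁ (c , c′) rewrite a | a′ | b | b′ | c | c′ = s≤s z≤n
    ... | inj₂ (inj₂ (a , a′)) | inj₁ (b , b′) | inj₂ (inj₂ (c , c′)) rewrite a | a′ | b | b′ | c | c′ = s≤s z≤n
    ... | inj₂ (inj₂ (a , a′)) | inj₂ (inj₂ (b , b′)) | inj₁ (c , c′) rewrite a | a′ | b | b′ | c | c′ = s≤s z≤n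
    ... | inj₂ (inj₂ (a , a′)) | inj₂ (inj₂ (b , b′)) | inj₂ (inj₂ (c , c′)) rewrite a | a′ | b | b′ | c | c′ = s≤s z≤n

  Z : ℕ
  Z = ∑³ (λ i j k → A i j * (N i k * N j k))

  -- Fix an ordered edge ij and a vertex k. The number of ends adjacent to k, plus one if neither
  -- is, equals one plus a further one if both are. Summed over all k and all ordered edges, the
  -- adjacencies to either end give the sum of squared degrees.
  degree-identity : 2 * ∑ (λ i → d i * d i) + Z ≡ ∑² A * n + ∑³ tri
  degree-identity = begin
    2 * ∑ (λ i → d i * d i) + Z
      ≡⟨ cong (λ x → x + Z) (cong (λ x → D + x) (+-identityʳ D)) ⟩
    D + D + Z
      ≡⟨ cong₂ (λ x y → x + y + Z) (≡-sym paths₁) (≡-sym paths₂) ⟩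
    ∑³ (λ i j k → A i j * A i k) + ∑³ (λ i j k → A i j * A j k) + Z
      ≡⟨ cong (λ x → x + Z) (≡-sym (∑³-+ _ _)) ⟩
    ∑³ (λ i j k → A i j * A i k + A i j * A j k) + Z
      ≡⟨ ≡-sym (∑³-+ _ _) ⟩
    ∑³ (λ i j k → A i j * A i k + A i j * A j k + A i j * (N i k * N j k))
      ≡⟨ ∑³-cong (λ i j k → inclusion-exclusion (Adj G i j) (Adj G i k) (Adj G j k)) ⟩
    ∑³ (λ i j k → A i j + tri i j k)
      ≡⟨ ∑³-+ _ _ ⟩
    ∑³ (λ i j k → A i j) + ∑³ tri
      ≡⟨ cong (λ x → x + ∑³ tri) (trans (∑²-cong (λ i j → ∑-const (A i j))) (∑²-*ʳ n A)) ⟩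
    ∑² A * n + ∑³ tri ∎
    where
    open ≡-Reasoning
    D : ℕ
    D = ∑ (λ i → d i * d i)
    inclusion-exclusion : ∀ x y z →
      ind x * ind y + ind x * ind z + ind x * (ind (not y) * ind (not z)) ≡ ind x + ind x * ind z * ind y
    inclusion-exclusion false y     z     = refl
    inclusion-exclusion true  false false = refl
    inclusion-exclusion true  false true  = refl
    inclusion-exclusion true  true  false = refl
    inclusion-exclusion true  true  true  = refl
    paths₁ : ∑³ (λ i j k → A i j * A i k) ≡ D
    paths₁ = ∑-cong (λ i → ∑-** (A i) (A i))
    paths₂ : ∑³ (λ i j k → A i j * A j k) ≡ D
    paths₂ = trans (∑³-swap₁₂ (λ j i k → A i j * A j k))
                   (trans (∑³-cong (λ i j k → cong (_* A i k) (A-sym j i))) paths₁)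

  -- The hypothesis is n² ≤ 4e, as `∑² A` counts ordered edges. It absorbs the cubic term left by
  -- `cauchy`, after which the terms in `E * n` cancel from the doubled identity.
  Z≤∑³tri : n * n ≤ 2 * ∑² A → Z ≤ ∑³ tri
  Z≤∑³tri nn≤2E = *-cancelˡ-≤ 2 (+-cancelˡ-≤ (4 * (E * n)) _ _ (begin
    4 * (E * n) + 2 * Z
      ≤⟨ +-monoˡ-≤ (2 * Z) cauchy ⟩
    4 * D + n * n * n + 2 * Z
      ≡⟨ e₁ D (n * n * n) Z ⟩
    2 * (2 * D + Z) + n * n * n
      ≡⟨ cong (λ x → 2 * x + n * n * n) degree-identity ⟩
    2 * (E * n + ∑³ tri) + n * n * n
      ≤⟨ +-monoʳ-≤ _ (*-monoˡ-≤ n nn≤2E) ⟩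
    2 * (E * n + ∑³ tri) + 2 * E * n
      ≡⟨ e₂ E n (∑³ tri) ⟩
    4 * (E * n) + 2 * ∑³ tri ∎))
    where
    open ≤-Reasoning
    E D : ℕ
    E = ∑² A
    D = ∑ (λ i → d i * d i)
    e₁ : ∀ D c Z → 4 * D + c + 2 * Z ≡ 2 * (2 * D + Z) + c
    e₁ = solve-∀
    e₂ : ∀ E n R → 2 * (E * n + R) + 2 * E * n ≡ 4 * (E * n) + 2 * R
    e₂ = solve-∀
    e₃ : ∀ d n → 2 * (2 * d * n) ≡ 4 * (d * n)
    e₃ = solve-∀
    e₄ : ∀ d → 2 * d * (2 * d) ≡ 4 * (d * d)
    e₄ = solve-∀
    -- The sum of (2d - n)² over all vertices is nonnegative, where d is the degree.
    cauchy : 4 * (E * n) ≤ 4 * D + n * n * n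
    cauchy = begin
      4 * (E * n)                           ≡⟨ cong (4 *_) (≡-sym (∑-*ʳ n d)) ⟩
      4 * ∑ (λ i → d i * n)                 ≡⟨ ≡-sym (∑-*ˡ 4 (λ i → d i * n)) ⟩
      ∑ (λ i → 4 * (d i * n))               ≤⟨ ∑-mono (λ i → subst₂ _≤_ (e₃ (d i) n) (cong (λ x → x + n * n) (e₄ (d i))) (2xy≤xx+yy (2 * d i) n)) ⟩
      ∑ (λ i → 4 * (d i * d i) + n * n)     ≡⟨ ∑-+ _ _ ⟩
      ∑ (λ i → 4 * (d i * d i)) + ∑ {n} (λ _ → n * n) ≡⟨ cong₂ _+_ (∑-*ˡ 4 (λ i → d i * d i)) (∑-const (n * n)) ⟩
      4 * D + n * n * n                     ∎

  codeg nondeg : Fin n → Fin n → ℕ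
  codeg i j = ∑ (λ k → A i k * A j k)
  nondeg i j = ∑ (λ k → N i k * N j k)

  trisAt : Fin n → ℕ
  trisAt i = ∑² (tri i)

  -- Weighting by `n` makes a single common neighbour or non-neighbour cost `n`, so a defect below
  -- `n` excludes both. The triangle terms bound the edges inside the resulting classes.
  defect : Fin n → Fin n → ℕ
  defect i j = n * codeg i j + n * nondeg i j + (trisAt i + trisAt j)

  -- Over ordered edges `codeg` sums to `∑³ tri` and `nondeg` to `Z`, which is no larger. The two
  -- triangle terms are summed over all pairs, adjacent or not, and give `n * ∑³ tri` each.
  ∑²defect≤ : Z ≤ ∑³ tri → ∑² (λ i j → A i j * defect i j) ≤ 4 * n * ∑³ tri
  ∑²defect≤ Z≤R = begin
    ∑² (λ i j → A i j * defect i j)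
      ≤⟨ ∑²-mono bound ⟩
    ∑² (λ i j → n * (A i j * codeg i j) + n * (A i j * nondeg i j) + (trisAt i + trisAt j))
      ≡⟨ trans (∑²-+ _ _) (cong₂ _+_ (∑²-+ _ _) (∑²-+ _ _)) ⟩
    ∑² (λ i j → n * (A i j * codeg i j)) + ∑² (λ i j → n * (A i j * nondeg i j)) +
      (∑² (λ i j → trisAt i) + ∑² (λ i j → trisAt j))
      ≡⟨ cong₂ _+_ (cong₂ _+_ codegs nondegs) (cong₂ _+_ trisᵢ trisⱼ) ⟩
    n * R + n * Z + (R * n + R * n)
      ≤⟨ +-monoˡ-≤ _ (+-monoʳ-≤ (n * R) (*-monoʳ-≤ n Z≤R)) ⟩
    n * R + n * R + (R * n + R * n)
      ≡⟨ e n R ⟩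
    4 * n * R ∎
    where
    open ≤-Reasoning
    R : ℕ
    R = ∑³ tri
    e : ∀ n R → n * R + n * R + (R * n + R * n) ≡ 4 * n * R
    e = solve-∀
    expand : ∀ a n c z t → a * (n * c + n * z + t) ≡ n * (a * c) + n * (a * z) + a * t
    expand = solve-∀
    bound : ∀ i j → A i j * defect i j ≤ n * (A i j * codeg i j) + n * (A i j * nondeg i j) + (trisAt i + trisAt j)
    bound i j = ≤-trans (≤-reflexive (expand (A i j) n (codeg i j) (nondeg i j) _))
                        (+-monoʳ-≤ _ (ind*≤ (Adj G i j) _))
    rearrange : ∀ a b c → a * (b * c) ≡ a * c * b
    rearrange = solve-∀
    codegs : ∑² (λ i j → n * (A i j * codeg i j)) ≡ n * R
    codegs = trans (∑²-*ˡ n _) (cong (n *_) (∑²-cong (λ i j →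
      trans (≡-sym (∑-*ˡ (A i j) _)) (∑-cong (λ k → rearrange (A i j) (A i k) (A j k))))))
    nondegs : ∑² (λ i j → n * (A i j * nondeg i j)) ≡ n * Z
    nondegs = trans (∑²-*ˡ n _) (cong (n *_) (∑²-cong (λ i j → ≡-sym (∑-*ˡ (A i j) _))))
    trisᵢ : ∑² (λ i j → trisAt i) ≡ R * n
    trisᵢ = trans (∑-cong (λ i → ∑-const (trisAt i))) (∑-*ʳ n trisAt)
    trisⱼ : ∑² (λ i j → trisAt j) ≡ R * n
    trisⱼ = ∑-const R

  light-edge : ∀ K → Z ≤ ∑³ tri → 4 * n * ∑³ tri < ∑² A * suc K →
               ∃₂ λ i j → Adj G i j ≡ true × defect i j ≤ K
  light-edge K Z≤R lt = select (∑²-< (begin-strict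
    ∑² (λ i j → A i j * defect i j)    ≤⟨ ∑²defect≤ Z≤R ⟩
    4 * n * ∑³ tri                     <⟨ lt ⟩
    ∑² A * suc K                       ≡⟨ ≡-sym (∑²-*ʳ (suc K) A) ⟩
    ∑² (λ i j → A i j * suc K)         ∎))
    where
    open ≤-Reasoning
    cancel : ∀ x y → ind x * y < ind x * suc K → x ≡ true × y ≤ K
    cancel true y lt = refl , ≤-pred (subst₂ _<_ (+-identityʳ y) (+-identityʳ (suc K)) lt)
    select : (∃₂ λ i j → A i j * defect i j < A i j * suc K) → ∃₂ λ i j → Adj G i j ≡ true × defect i j ≤ K
    select (i , j , lt) = i , j , cancel (Adj G i j) (defect i j) lt

  inner : (Fin n → Bool) → Fin n → Fin n → Bool
  inner c k l = not (c k xor c l) ∧ Adj G k l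

  -- The classes are the neighbourhood of i and its complement, which is the neighbourhood of j
  -- because i and j have no common neighbour and no common non-neighbour. So an edge within a class
  -- spans a triangle with i or with j.
  near-bipartition : ∀ i j → defect i j < n →
                     ∑² (λ k l → ind (inner (Adj G i) k l)) ≤ defect i j
  near-bipartition i j df<n = ≤-trans
    (≤-trans (∑²-mono bound) (≤-reflexive (∑²-+ (tri i) (tri j)))) (m≤n+m _ (n * codeg i j + n * nondeg i j))
    where
    small : ∀ x → n * x < n → x ≡ 0
    small zero _ = refl
    small (suc x) lt = contradiction (≤-trans (≤-reflexive (≡-sym (*-identityʳ n))) (*-monoʳ-≤ n (s≤s z≤n))) (<⇒≱ lt)
    codeg≡0 : codeg i j ≡ 0
    codeg≡0 = small _ (≤-<-trans (≤-trans (m≤m+n _ _) (m≤m+n _ _)) df<n)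
    nondeg≡0 : nondeg i j ≡ 0
    nondeg≡0 = small _ (≤-<-trans (≤-trans (m≤n+m _ (n * codeg i j)) (m≤m+n _ _)) df<n)
    complementary : ∀ k → Adj G j k ≡ not (Adj G i k)
    complementary k with Adj G i k | Adj G j k
                       | subst (A i k * A j k ≤_) codeg≡0 (≤-∑ (λ k → A i k * A j k) k)
                       | subst (N i k * N j k ≤_) nondeg≡0 (≤-∑ (λ k → N i k * N j k) k)
    ... | true  | false | _ | _ = refl
    ... | false | true  | _ | _ = refl
    ... | true  | true  | () | _
    ... | false | false | _ | ()
    bound : ∀ k l → ind (inner (Adj G i) k l) ≤ tri i k l + tri j k l
    bound k l rewrite complementary k | complementary l with Adj G i k | Adj G i l | Adj G k l
    ... | true  | true  | true  = ≤-refl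
    ... | true  | true  | false = z≤n
    ... | true  | false | _     = z≤n
    ... | false | true  | _     = z≤n
    ... | false | false | true  = ≤-refl
    ... | false | false | false = z≤n

-- Vertex sets given as supports of weights.

support : ∀ {n} → (Fin n → ℕ) → Subset n
support v = tabulate (λ k → 0 <ᵇ v k)

∣support∣≤∑ : ∀ {n} (v : Fin n → ℕ) → ∣ support v ∣ ≤ ∑ v
∣support∣≤∑ {zero}  v = z≤n
∣support∣≤∑ {suc n} v rewrite ∑-suc v with v zero
... | zero  = ∣support∣≤∑ (v ∘ suc)
... | suc x = s≤s (≤-trans (∣support∣≤∑ (v ∘ suc)) (m≤n+m _ x))

∈-support : ∀ {n} (v : Fin n → ℕ) k → 1 ≤ v k → k ∈ˢ support v
∈-support v k 1≤vk = lookup⇒[]= k _ (trans (lookup∘tabulate _ k) (positive (v k) 1≤vk))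
  where
  positive : ∀ x → 1 ≤ x → (0 <ᵇ x) ≡ true
  positive (suc x) _ = refl

ind-pos : ∀ {b} → b ≡ true → 1 ≤ ind b
ind-pos refl = ≤-refl

at : ∀ {n} → Fin n → Fin n → ℕ
at x k = ind ⌊ k ≟ꟳ x ⌋

∑-at : ∀ {n} (x : Fin n) → ∑ (at x) ≤ 1
∑-at {suc n} zero rewrite ∑-suc (at {suc n} zero) = ≤-reflexive (cong suc (∑-const 0))
∑-at {suc n} (suc x) rewrite ∑-suc (at (suc x)) = ≤-trans (≤-reflexive (∑-cong shift)) (∑-at x)
  where
  shift : ∀ k → at (suc x) (suc k) ≡ at x k
  shift k with k ≟ꟳ x
  ... | yes _ = refl
  ... | no  _ = refl

-- Graphs with a two-colouring: inner edges, covers, missing cross pairs and triangles.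

module Bipartition {n : ℕ} (G : Graph n) (c : Fin n → Bool) where

  open Counting G

  I : Fin n → Fin n → ℕ
  I k l = ind (inner c k l)

  innerDeg : Fin n → ℕ
  innerDeg k = ∑ (I k)

  innerEdges : ℕ
  innerEdges = ∑² (λ k l → ind (k ≺ l) * I k l)

  inner-sym : ∀ k l → inner c k l ≡ inner c l k
  inner-sym k l rewrite sym G k l with c k | c l
  ... | true  | true  = refl
  ... | true  | false = refl
  ... | false | true  = refl
  ... | false | false = refl

  inner-irrefl : ∀ k → inner c k k ≡ false
  inner-irrefl k rewrite irrefl G k with c k
  ... | true  = refl
  ... | false = refl

  I-sym : ∀ k l → I k l ≡ I l k
  I-sym k l = cong ind (inner-sym k l)

  ∑²I≡ : ∑² I ≡ 2 * innerEdges
  ∑²I≡ = ∑²-≺ I I-sym (λ k → cong ind (inner-irrefl k))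

  -- Two of the three vertices of a triangle lie in the same class.
  triangle-cover : ∀ S → (∀ k l → k ≺ l ≡ true → inner c k l ≡ true → k ∈ˢ S ⊎ l ∈ˢ S) → IsTriangleCover G S
  triangle-cover S hit i j k (ij , jk , ik) = pigeonhole (c i) (c j) (c k) refl refl refl
    where
    hit′ : ∀ k l → inner c k l ≡ true → k ∈ˢ S ⊎ l ∈ˢ S
    hit′ k l kl with ≺-split k l
    ... | inj₁ (k≺l , _) = hit k l k≺l kl
    ... | inj₂ (inj₁ refl) = contradiction (trans (≡-sym kl) (inner-irrefl k)) λ ()
    ... | inj₂ (inj₂ (_ , l≺k)) with hit l k l≺k (trans (inner-sym l k) kl)
    ...   | inj₁ l∈S = inj₂ l∈S
    ...   | inj₂ k∈S = inj₁ k∈S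
    same : ∀ {x y} b → c x ≡ b → c y ≡ b → Adj G x y ≡ true → x ∈ˢ S ⊎ y ∈ˢ S
    same {x} {y} b p q xy = hit′ x y (inner-true b p q xy)
      where
      inner-true : ∀ b → c x ≡ b → c y ≡ b → Adj G x y ≡ true → inner c x y ≡ true
      inner-true true  p q xy rewrite p | q | xy = refl
      inner-true false p q xy rewrite p | q | xy = refl
    fromᵢⱼ : i ∈ˢ S ⊎ j ∈ˢ S → i ∈ˢ S ⊎ (j ∈ˢ S ⊎ k ∈ˢ S)
    fromᵢⱼ (inj₁ x) = inj₁ x
    fromᵢⱼ (inj₂ x) = inj₂ (inj₁ x)
    fromᵢₖ : i ∈ˢ S ⊎ k ∈ˢ S → i ∈ˢ S ⊎ (j ∈ˢ S ⊎ k ∈ˢ S)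
    fromᵢₖ (inj₁ x) = inj₁ x
    fromᵢₖ (inj₂ x) = inj₂ (inj₂ x)
    pigeonhole : ∀ x y z → c i ≡ x → c j ≡ y → c k ≡ z → i ∈ˢ S ⊎ (j ∈ˢ S ⊎ k ∈ˢ S)
    pigeonhole true  true  z     p q r = fromᵢⱼ (same true p q ij)
    pigeonhole false false z     p q r = fromᵢⱼ (same false p q ij)
    pigeonhole true  false true  p q r = fromᵢₖ (same true p r ik)
    pigeonhole false true  false p q r = fromᵢₖ (same false p r ik)
    pigeonhole true  false false p q r = inj₂ (same false q r jk)
    pigeonhole false true  true  p q r = inj₂ (same true q r jk)

  module _ {s : ℕ} (τ≥s : TriangleCoverNumberAtLeast G s) where

    -- The endpoints of smaller index of all inner edges form a triangle cover.
    s≤innerEdges : s ≤ innerEdges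
    s≤innerEdges = ≤-trans (τ≥s (support v) (triangle-cover _ hit)) (∣support∣≤∑ v)
      where
      v : Fin n → ℕ
      v k = ∑ (λ l → ind (k ≺ l) * I k l)
      hit : ∀ k l → k ≺ l ≡ true → inner c k l ≡ true → k ∈ˢ support v ⊎ l ∈ˢ support v
      hit k l k≺l kl = inj₁ (∈-support v k
        (≤-trans (*-mono-≤ (ind-pos k≺l) (ind-pos kl)) (≤-∑ (λ l → ind (k ≺ l) * I k l) l)))

    -- Cover the inner edges at x by x itself and the others by one endpoint each.
    s+innerDeg≤ : ∀ x → s + innerDeg x ≤ suc innerEdges
    s+innerDeg≤ x = begin
      s + innerDeg x                 ≤⟨ +-monoˡ-≤ _ (τ≥s (support v) (triangle-cover _ hit)) ⟩
      ∣ support v ∣ + innerDeg x      ≤⟨ +-monoˡ-≤ _ (∣support∣≤∑ v) ⟩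
      ∑ v + innerDeg x               ≡⟨ cong (λ y → y + innerDeg x) (∑-+ (at x) _) ⟩
      ∑ (at x) + m′ + innerDeg x     ≤⟨ +-monoˡ-≤ (innerDeg x) (+-monoˡ-≤ m′ (∑-at x)) ⟩
      suc (m′ + innerDeg x)          ≤⟨ s≤s (*-cancelˡ-≤ 2 double) ⟩
      suc innerEdges                 ∎
      where
      open ≤-Reasoning
      off : Fin n → ℕ
      off k = ind (not ⌊ k ≟ꟳ x ⌋)
      J : Fin n → Fin n → ℕ
      J k l = off k * off l * I k l
      m′ : ℕ
      m′ = ∑² (λ k l → ind (k ≺ l) * J k l)
      v : Fin n → ℕ
      v k = at x k + ∑ (λ l → ind (k ≺ l) * J k l)
      at-x : at x x ≡ 1
      at-x with x ≟ꟳ x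
      ... | yes _  = refl
      ... | no x≢x = contradiction refl x≢x
      hit : ∀ k l → k ≺ l ≡ true → inner c k l ≡ true → k ∈ˢ support v ⊎ l ∈ˢ support v
      hit k l k≺l kl with k ≟ꟳ x in ek | l ≟ꟳ x in el
      ... | yes refl | _ = inj₁ (∈-support v k (≤-trans (≤-reflexive (≡-sym at-x)) (m≤m+n _ _)))
      ... | no _ | yes refl = inj₂ (∈-support v l (≤-trans (≤-reflexive (≡-sym at-x)) (m≤m+n _ _)))
      ... | no _ | no _ = inj₁ (∈-support v k (≤-trans
              (≤-trans (*-mono-≤ (ind-pos k≺l) J≥1) (≤-∑ (λ l → ind (k ≺ l) * J k l) l)) (m≤n+m _ (at x k))))
        where
        J≥1 : 1 ≤ J k l
        J≥1 rewrite ek | el = ≤-trans (ind-pos kl) (≤-reflexive (≡-sym (+-identityʳ _)))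
      swap : ∀ a b c → a * b * c ≡ b * a * c
      swap = solve-∀
      -- An inner edge is seen by `J` if it avoids `x`, and by one of the other two terms if it
      -- meets `x`. Only `x` paired with itself is seen twice, and that is no edge.
      pointwise : ∀ k l → J k l + (at x k * I k l + at x l * I k l) ≤ I k l
      pointwise k l with k ≟ꟳ x | l ≟ꟳ x
      ... | yes refl | yes refl rewrite inner-irrefl k = z≤n
      ... | yes _ | no _ = ≤-reflexive (trans (+-identityʳ _) (+-identityʳ _))
      ... | no _ | yes _ = ≤-reflexive (+-identityʳ _)
      ... | no _ | no _ = ≤-reflexive (trans (+-identityʳ _) (+-identityʳ _))
      deg≤₁ : innerDeg x ≤ ∑² (λ k l → at x k * I k l)
      deg≤₁ = ≤-trans (≤-reflexive (trans (≡-sym (*-identityˡ _)) (trans (cong (_* innerDeg x) (≡-sym at-x)) (≡-sym (∑-*ˡ (at x x) (I x))))))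
                      (≤-∑ (λ k → ∑ (λ l → at x k * I k l)) x)
      deg≤₂ : innerDeg x ≤ ∑² (λ k l → at x l * I k l)
      deg≤₂ = ≤-trans deg≤₁ (≤-reflexive (trans (∑-comm _) (∑²-cong (λ k l → cong (at x l *_) (I-sym l k)))))
      J-irrefl : ∀ k → J k k ≡ 0
      J-irrefl k rewrite inner-irrefl k = *-zeroʳ (off k * off k)
      double : 2 * (m′ + innerDeg x) ≤ 2 * innerEdges
      double = begin
        2 * (m′ + innerDeg x)
          ≡⟨ *-distribˡ-+ 2 m′ _ ⟩
        2 * m′ + 2 * innerDeg x
          ≡⟨ cong₂ _+_ (≡-sym (∑²-≺ J (λ k l → trans (swap (off k) (off l) (I k l)) (cong (off l * off k *_) (I-sym k l))) J-irrefl))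
                       (cong (innerDeg x +_) (+-identityʳ _)) ⟩
        ∑² J + (innerDeg x + innerDeg x)
          ≤⟨ +-monoʳ-≤ (∑² J) (+-mono-≤ deg≤₁ deg≤₂) ⟩
        ∑² J + (∑² (λ k l → at x k * I k l) + ∑² (λ k l → at x l * I k l))
          ≡⟨ cong (∑² J +_) (≡-sym (∑²-+ _ _)) ⟩
        ∑² J + ∑² (λ k l → at x k * I k l + at x l * I k l)
          ≡⟨ ≡-sym (∑²-+ _ _) ⟩
        ∑² (λ k l → J k l + (at x k * I k l + at x l * I k l))
          ≤⟨ ∑²-mono pointwise ⟩
        ∑² I
          ≡⟨ ∑²I≡ ⟩
        2 * innerEdges ∎

  p q : Fin n → ℕ
  p k = ind (c k)
  q k = ind (not (c k))

  a b : ℕ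
  a = ∑ p
  b = ∑ q

  a+b≡n : a + b ≡ n
  a+b≡n = trans (≡-sym (∑-+ p q)) (trans (∑-cong one) (trans (∑-const 1) (*-identityˡ n)))
    where
    one : ∀ k → p k + q k ≡ 1
    one k with c k
    ... | true  = refl
    ... | false = refl

  missing : ℕ
  missing = ∑² (λ k r → p k * q r * N k r)

  module Side (u v : Fin n → ℕ) where

    inside : Fin n → Fin n → ℕ
    inside k l = u k * u l * A k l

    edges : ℕ
    edges = ∑² (λ k l → ind (k ≺ l) * inside k l)

    -- A triangle with its base in the class of `u` and its apex in the class of `v` appears twice,
    -- once for each order of the base.
    cherries : Fin n → Fin n → Fin n → ℕ
    cherries k l r = u k * u l * v r * tri k l r

    ∑²inside≡ : ∑² inside ≡ 2 * edges
    ∑²inside≡ = ∑²-≺ inside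
      (λ k l → cong₂ _*_ (*-comm (u k) (u l)) (A-sym k l))
      (λ k → trans (cong (λ y → u k * u k * ind y) (irrefl G k)) (*-zeroʳ (u k * u k)))

    ∑inside≤ : ∀ k → ∑ (inside k) ≤ 2 * edges
    ∑inside≤ k = ≤-trans (≤-∑ (λ k → ∑ (inside k)) k) (≤-reflexive ∑²inside≡)

    -- An inner edge forms a triangle with every vertex of the other class unless a pair at one of
    -- its ends is missing. A missing pair at `k` spoils at most `δ` such triangles, one per inner
    -- edge at `k`. The factors 2 come from ordering the ends of inner edges.
    edges-bound : ∀ δ → (∀ k → ∑ (inside k) ≤ u k * δ) →
      2 * edges * ∑ v ≤ ∑³ cherries + 2 * (δ * ∑² (λ k r → u k * v r * N k r))
    edges-bound δ deg≤δ = begin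
      2 * edges * ∑ v
        ≡⟨ cong (_* ∑ v) (≡-sym ∑²inside≡) ⟩
      ∑² inside * ∑ v
        ≡⟨ ≡-sym (trans (∑²-cong (λ k l → ∑-*ˡ (inside k l) v)) (∑²-*ʳ (∑ v) inside)) ⟩
      ∑³ (λ k l r → inside k l * v r)
        ≤⟨ ∑³-mono pointwise ⟩
      ∑³ (λ k l r → cherries k l r + (lost k l r + lost l k r))
        ≡⟨ trans (∑³-+ _ _) (cong (∑³ cherries +_) (∑³-+ _ _)) ⟩
      ∑³ cherries + (∑³ lost + ∑³ (λ k l r → lost l k r))
        ≡⟨ cong (λ y → ∑³ cherries + (∑³ lost + y)) (trans (∑³-swap₁₂ lost) (≡-sym (+-identityʳ _))) ⟩
      ∑³ cherries + 2 * ∑³ lost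
        ≤⟨ +-monoʳ-≤ (∑³ cherries) (*-monoʳ-≤ 2 lost≤) ⟩
      ∑³ cherries + 2 * (δ * ∑² (λ k r → u k * v r * N k r)) ∎
      where
      open ≤-Reasoning
      miss : Fin n → ℕ
      miss k = ∑ (λ r → v r * N k r)
      lost : Fin n → Fin n → Fin n → ℕ
      lost k l r = inside k l * (v r * N k r)
      pointwise : ∀ k l r → inside k l * v r ≤ cherries k l r + (lost k l r + lost l k r)
      pointwise k l r rewrite sym G l k with Adj G k l | Adj G k r | Adj G l r
      ... | x | y | z = subst₂ _≤_ (e₁ (u k) (u l) (v r) (ind x))
              (e₂ (u k) (u l) (v r) (ind x) (ind y) (ind z) (ind (not y)) (ind (not z)))
              (*-monoʳ-≤ (u k * u l * v r) (bool x y z))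
        where
        bool : ∀ x y z → ind x ≤ ind x * ind z * ind y + (ind x * ind (not y) + ind x * ind (not z))
        bool false y     z     = z≤n
        bool true  false false = s≤s z≤n
        bool true  false true  = s≤s z≤n
        bool true  true  false = s≤s z≤n
        bool true  true  true  = s≤s z≤n
        e₁ : ∀ k l r x → k * l * r * x ≡ k * l * x * r
        e₁ = solve-∀
        e₂ : ∀ k l r x y z y′ z′ → k * l * r * (x * z * y + (x * y′ + x * z′)) ≡
             k * l * r * (x * z * y) + (k * l * x * (r * y′) + l * k * x * (r * z′))
        e₂ = solve-∀
      factor : ∀ k δ m → k * δ * m ≡ δ * (k * m)
      factor = solve-∀
      -- The factor `u k` in the degree hypothesis keeps the missing pairs restricted to the class
      -- of `u` once the degrees are replaced by `δ`.
      lost≤ : ∑³ lost ≤ δ * ∑² (λ k r → u k * v r * N k r)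
      lost≤ = begin
        ∑³ lost                               ≡⟨ ∑-cong (λ k → ∑-** (inside k) (λ r → v r * N k r)) ⟩
        ∑ (λ k → ∑ (inside k) * miss k)       ≤⟨ ∑-mono (λ k → *-monoˡ-≤ (miss k) (deg≤δ k)) ⟩
        ∑ (λ k → u k * δ * miss k)            ≡⟨ ∑-cong (λ k → factor (u k) δ (miss k)) ⟩
        ∑ (λ k → δ * (u k * miss k))          ≡⟨ ∑-*ˡ δ _ ⟩
        δ * ∑ (λ k → u k * miss k)            ≡⟨ cong (δ *_) (∑-cong (λ k → trans (≡-sym (∑-*ˡ (u k) _)) (∑-cong (λ r → ≡-sym (*-assoc (u k) (v r) (N k r)))))) ⟩
        δ * ∑² (λ k r → u k * v r * N k r)    ∎

  module P = Side p q
  module Q = Side q p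

  -- A triangle meeting both classes has exactly one base within a class and is counted once for
  -- each order of it; a triangle inside a class is not counted. Symmetrising reduces this to a
  -- check on three colours.
  cherries≤2T : ∑³ P.cherries + ∑³ Q.cherries ≤ 2 * triangleCount G
  cherries≤2T = *-cancelˡ-≤ 6 (begin
    6 * (∑³ P.cherries + ∑³ Q.cherries)   ≡⟨ cong (6 *_) (≡-sym (∑³-+ _ _)) ⟩
    6 * ∑³ f                              ≡⟨ ≡-sym (∑³-symm f) ⟩
    ∑³ (symm f)                           ≤⟨ ∑³-mono pointwise ⟩
    ∑³ (λ i j k → tri i j k + tri i j k)  ≡⟨ ∑³-+ tri tri ⟩
    ∑³ tri + ∑³ tri                       ≤⟨ +-mono-≤ ∑³tri≤6T ∑³tri≤6T ⟩
    6 * t + 6 * t                         ≡⟨ e t ⟩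
    6 * (2 * t)                           ∎)
    where
    open ≤-Reasoning
    t : ℕ
    t = triangleCount G
    e : ∀ t → 6 * t + 6 * t ≡ 6 * (2 * t)
    e = solve-∀
    f : Fin n → Fin n → Fin n → ℕ
    f i j k = P.cherries i j k + Q.cherries i j k
    -- The multiplicity of `tri i j k` after symmetrisation: at the colour indicators it is 0 if all
    -- three colours agree and 2 otherwise.
    coefficient : ℕ → ℕ → ℕ → ℕ → ℕ → ℕ → ℕ
    coefficient x y z x′ y′ z′ =
      2 * (x * y * z′) + 2 * (x * z * y′) + 2 * (y * z * x′) +
      (2 * (x′ * y′ * z) + 2 * (x′ * z′ * y) + 2 * (y′ * z′ * x))
    coefficient≤2 : ∀ x y z → coefficient (ind x) (ind y) (ind z) (ind (not x)) (ind (not y)) (ind (not z)) ≤ 2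
    coefficient≤2 true  true  true  = z≤n
    coefficient≤2 true  true  false = ≤-refl
    coefficient≤2 true  false true  = ≤-refl
    coefficient≤2 true  false false = ≤-refl
    coefficient≤2 false true  true  = ≤-refl
    coefficient≤2 false true  false = ≤-refl
    coefficient≤2 false false true  = ≤-refl
    coefficient≤2 false false false = z≤n
    collect : ∀ x y z x′ y′ z′ a b c →
      (2 * (x * y * z′) + 2 * (x * z * y′) + 2 * (y * z * x′) +
      (2 * (x′ * y′ * z) + 2 * (x′ * z′ * y) + 2 * (y′ * z′ * x))) * (a * b * c) ≡
      x * y * z′ * (a * b * c) + x′ * y′ * z * (a * b * c) +
      (x * z * y′ * (c * b * a) + x′ * z′ * y * (c * b * a)) +
      (y * x * z′ * (a * c * b) + y′ * x′ * z * (a * c * b) +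
      (y * z * x′ * (b * c * a) + y′ * z′ * x * (b * c * a))) +
      (z * x * y′ * (c * a * b) + z′ * x′ * y * (c * a * b) +
      (z * y * x′ * (b * a * c) + z′ * y′ * x * (b * a * c)))
    collect = solve-∀
    twice : ∀ x → 2 * x ≡ x + x
    twice = solve-∀
    pointwise : ∀ i j k → symm f i j k ≤ tri i j k + tri i j k
    pointwise i j k rewrite sym G j i | sym G k j | sym G k i = subst₂ _≤_
      (collect (p i) (p j) (p k) (q i) (q j) (q k) (A i j) (A j k) (A i k))
      (twice (tri i j k))
      (*-monoˡ-≤ (tri i j k) (coefficient≤2 (c i) (c j) (c k)))

  -- A missing cross pair spoils at most `δ` triangles over inner edges at its first end and `δ′`
  -- over those at its second. The constants stay separate so that a class without inner edges can
  -- contribute 0.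
  triangles-bound : ∀ δ δ′ → (∀ k → ∑ (P.inside k) ≤ p k * δ) → (∀ k → ∑ (Q.inside k) ≤ q k * δ′) →
    P.edges * b + Q.edges * a ≤ triangleCount G + (δ + δ′) * missing
  triangles-bound δ δ′ H H′ = *-cancelˡ-≤ 2 (begin
    2 * (P.edges * b + Q.edges * a)                  ≡⟨ e₁ P.edges b Q.edges a ⟩
    2 * P.edges * b + 2 * Q.edges * a                ≤⟨ +-mono-≤ (P.edges-bound δ H) (Q.edges-bound δ′ H′) ⟩
    ∑³ P.cherries + 2 * (δ * missing) + (∑³ Q.cherries + 2 * (δ′ * ∑² (λ k r → q k * p r * N k r)))
      ≡⟨ cong (λ y → ∑³ P.cherries + 2 * (δ * missing) + (∑³ Q.cherries + 2 * (δ′ * y))) missing-sym ⟩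
    ∑³ P.cherries + 2 * (δ * missing) + (∑³ Q.cherries + 2 * (δ′ * missing))
      ≡⟨ e₂ (∑³ P.cherries) (∑³ Q.cherries) δ δ′ missing ⟩
    ∑³ P.cherries + ∑³ Q.cherries + 2 * ((δ + δ′) * missing)   ≤⟨ +-monoˡ-≤ _ cherries≤2T ⟩
    2 * triangleCount G + 2 * ((δ + δ′) * missing)   ≡⟨ ≡-sym (*-distribˡ-+ 2 (triangleCount G) _) ⟩
    2 * (triangleCount G + (δ + δ′) * missing)       ∎)
    where
    open ≤-Reasoning
    e₁ : ∀ x b y a → 2 * (x * b + y * a) ≡ 2 * x * b + 2 * y * a
    e₁ = solve-∀
    e₂ : ∀ x y δ δ′ m → x + 2 * (δ * m) + (y + 2 * (δ′ * m)) ≡ x + y + 2 * ((δ + δ′) * m)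
    e₂ = solve-∀
    missing-sym : ∑² (λ k r → q k * p r * N k r) ≡ missing
    missing-sym = trans (∑-comm _) (∑²-cong (λ k r → cong₂ _*_ (*-comm (q r) (p k)) (N-sym r k)))

  I-split : ∀ k l → I k l ≡ P.inside k l + Q.inside k l
  I-split k l with c k | c l
  ... | true  | true  = ≡-sym (trans (+-identityʳ _) (+-identityʳ _))
  ... | true  | false = refl
  ... | false | true  = refl
  ... | false | false = ≡-sym (+-identityʳ _)

  P+Q-edges : P.edges + Q.edges ≡ innerEdges
  P+Q-edges = trans (≡-sym (∑²-+ _ _)) (∑²-cong (λ k l →
    trans (≡-sym (*-distribˡ-+ (ind (k ≺ l)) (P.inside k l) (Q.inside k l))) (cong (ind (k ≺ l) *_) (≡-sym (I-split k l)))))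

  P-inside≤ : ∀ {δ} → (∀ k → innerDeg k ≤ δ) → ∀ k → ∑ (P.inside k) ≤ p k * δ
  P-inside≤ {δ} deg≤ k with c k in e
  ... | false = ≤-reflexive (∑-const 0)
  ... | true  = ≤-trans (∑-mono (λ l → subst (λ x → ind x * p l * A k l ≤ I k l) e
                  (≤-trans (m≤m+n _ _) (≤-reflexive (≡-sym (I-split k l))))))
                  (≤-trans (deg≤ k) (≤-reflexive (≡-sym (+-identityʳ δ))))

  Q-inside≤ : ∀ {δ} → (∀ k → innerDeg k ≤ δ) → ∀ k → ∑ (Q.inside k) ≤ q k * δ
  Q-inside≤ {δ} deg≤ k with c k in e
  ... | true  = ≤-reflexive (∑-const 0)
  ... | false = ≤-trans (∑-mono (λ l → subst (λ x → ind (not x) * q l * A k l ≤ I k l) e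
                  (≤-trans (m≤n+m _ (P.inside k l)) (≤-reflexive (≡-sym (I-split k l))))))
                  (≤-trans (deg≤ k) (≤-reflexive (≡-sym (+-identityʳ δ))))

  innerDeg≤ : ∀ k → innerDeg k ≤ 2 * innerEdges
  innerDeg≤ k = ≤-trans (≤-∑ innerDeg k) (≤-reflexive ∑²I≡)

  -- Every edge is inner or crossing, and the crossing edges together with the missing pairs make up
  -- all `a * b` cross pairs. The computation is doubled because it sums over ordered pairs.
  edges+missing : edgeCount G + missing ≡ innerEdges + a * b
  edges+missing = *-cancelˡ-≡ _ _ 2 (begin
    2 * (edgeCount G + missing)
      ≡⟨ *-distribˡ-+ 2 (edgeCount G) missing ⟩
    2 * edgeCount G + 2 * missing
      ≡⟨ cong (λ x → x + 2 * missing) (≡-sym ∑²A≡2e) ⟩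
    ∑² A + 2 * missing
      ≡⟨ cong (λ x → x + 2 * missing) (trans (∑²-cong split) (trans (∑²-+ _ _) (cong (∑² I +_) (∑²-+ _ _)))) ⟩
    ∑² I + (∑² cross + ∑² (λ k l → cross l k)) + 2 * missing
      ≡⟨ cong₂ (λ x y → x + (∑² cross + y) + 2 * missing) ∑²I≡ (≡-sym (∑-comm cross)) ⟩
    2 * innerEdges + (∑² cross + ∑² cross) + 2 * missing
      ≡⟨ e innerEdges (∑² cross) missing ⟩
    2 * (innerEdges + (∑² cross + missing))
      ≡⟨ cong (λ x → 2 * (innerEdges + x)) (trans (≡-sym (∑²-+ _ _)) (trans (∑²-cong total) (∑-** p q))) ⟩
    2 * (innerEdges + a * b) ∎)
    where
    open ≡-Reasoning
    cross : Fin n → Fin n → ℕ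
    cross k l = p k * q l * A k l
    e : ∀ m x y → 2 * m + (x + x) + 2 * y ≡ 2 * (m + (x + y))
    e = solve-∀
    split : ∀ k l → A k l ≡ I k l + (cross k l + cross l k)
    split k l rewrite sym G l k with c k | c l | Adj G k l
    ... | true  | true  | true  = refl
    ... | true  | true  | false = refl
    ... | true  | false | true  = refl
    ... | true  | false | false = refl
    ... | false | true  | true  = refl
    ... | false | true  | false = refl
    ... | false | false | true  = refl
    ... | false | false | false = refl
    total : ∀ k l → cross k l + p k * q l * N k l ≡ p k * q l
    total k l with Adj G k l
    ... | true  = trans (cong₂ _+_ (*-identityʳ (p k * q l)) (*-zeroʳ (p k * q l))) (+-identityʳ _)
    ... | false = trans (cong₂ _+_ (*-zeroʳ (p k * q l)) (*-identityʳ (p k * q l))) refl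

-- Parity of `n`, and the floors and ceilings of the statement.

record Halves (n f o : ℕ) : Set where
  field
    o≤1     : o ≤ 1
    n≡2f+o  : n ≡ 2 * f + o
    floor≡  : n / 2 ≡ f
    ceil≡   : suc n / 2 ≡ f + o
    odd≡    : oddInd n ≡ ℤ.+ o
    square≡ : (n * n) / 4 ≡ f * f + o * f

-- A single split by parity turns every truncated division into a polynomial in `f`, the floor of
-- n/2, and `o`, the parity of `n`.
halves : ∀ n → ∃₂ (Halves n)
halves n with parity n
  where
  parity : ∀ n → ∃ λ f → n ≡ f * 2 ⊎ n ≡ suc (f * 2)
  parity zero    = 0 , inj₁ refl
  parity (suc n) with parity n
  ... | f , inj₁ refl = f , inj₂ refl
  ... | f , inj₂ refl = suc f , inj₁ refl
... | f , inj₁ refl = f , 0 , record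
  { o≤1     = z≤n
  ; n≡2f+o  = e₁ f
  ; floor≡  = m*n/n≡m f 2
  ; ceil≡   = trans (+-distrib-/-∣ʳ 1 {d = 2} (divides f refl)) (trans (m*n/n≡m f 2) (≡-sym (+-identityʳ f)))
  ; odd≡    = oddInd-2f f
  ; square≡ = trans (cong (_/ 4) (e₂ f)) (trans (m*n/n≡m (f * f) 4) (≡-sym (+-identityʳ _)))
  }
  where
  e₁ : ∀ f → f * 2 ≡ 2 * f + 0
  e₁ = solve-∀
  e₂ : ∀ f → f * 2 * (f * 2) ≡ f * f * 4
  e₂ = solve-∀
  oddInd-2f : ∀ f → oddInd (f * 2) ≡ ℤ.+ 0
  oddInd-2f zero    = refl
  oddInd-2f (suc f) = oddInd-2f f
... | f , inj₂ refl = f , 1 , record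
  { o≤1     = ≤-refl
  ; n≡2f+o  = e₁ f
  ; floor≡  = trans (+-distrib-/-∣ʳ 1 {d = 2} (divides f refl)) (m*n/n≡m f 2)
  ; ceil≡   = trans (m*n/n≡m (suc f) 2) (+-comm 1 f)
  ; odd≡    = oddInd-2f+1 f
  ; square≡ = trans (cong (_/ 4) (e₂ f)) (trans (+-distrib-/-∣ʳ 1 {d = 4} (divides (f * f + 1 * f) refl)) (m*n/n≡m (f * f + 1 * f) 4))
  }
  where
  e₁ : ∀ f → 1 + f * 2 ≡ 2 * f + 1
  e₁ = solve-∀
  e₂ : ∀ f → (1 + f * 2) * (1 + f * 2) ≡ 1 + (f * f + 1 * f) * 4
  e₂ = solve-∀
  oddInd-2f+1 : ∀ f → oddInd (suc (f * 2)) ≡ ℤ.+ 1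
  oddInd-2f+1 zero    = refl
  oddInd-2f+1 (suc f) = oddInd-2f+1 f

-- Upper bounds for the two minima.

x≤x*x : ∀ x → x ≤ x * x
x≤x*x zero    = z≤n
x≤x*x (suc x) = m≤m*n (suc x) (suc x)

foldr-⊓-≤ : ∀ {A : Set} (g : A → ℤ.ℤ) z {xs x} → x ∈ xs → foldr ℤ._⊓_ z (map g xs) ℤ.≤ g x
foldr-⊓-≤ g z (here refl)  = ℤ.i⊓j≤i _ _
foldr-⊓-≤ g z (there x∈xs) = ℤ.≤-trans (ℤ.i⊓j≤j _ _) (foldr-⊓-≤ g z x∈xs)

-- The hypothesis is the equation α(x) = `M` solved for `s`. As `M` is a natural number, `x` lies in
-- the index set, and each minimum is at most its value at `x`.
module Target {s t n f o : ℕ} (h : Halves n f o) {x M : ℕ} (s≡ : s ≡ t + M + x * x + o * x) where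

  open Halves h

  α≡M : α s t n x ≡ ℤ.+ M
  α≡M = trans (cong₂ (λ u v → u ℤ.- ℤ.+ t ℤ.- ℤ.+ x ℤ.* ℤ.+ x ℤ.- v ℤ.* ℤ.+ x)
                     (trans (cong ℤ.+_ s≡) (cong₂ (λ u v → ℤ.+ t ℤ.+ ℤ.+ M ℤ.+ u ℤ.+ v) (ℤ.pos-* x x) (ℤ.pos-* o x)))
                     odd≡)
              (e (ℤ.+ t) (ℤ.+ M) (ℤ.+ x) (ℤ.+ o))
    where
    e : ∀ t M x o → (t ℤ.+ M ℤ.+ x ℤ.* x ℤ.+ o ℤ.* x ℤ.- t) ℤ.- x ℤ.* x ℤ.- o ℤ.* x ≡ M
    e = ℤ-Solver.solve-∀

  minOverI-≤ : ∀ g → minOverI s t n g ℤ.≤ g x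
  minOverI-≤ g = foldr-⊓-≤ g (g 0)
    (∈-filter⁺ (λ a → ℤ.+ 0 ℤ.≤? α s t n a) (∈-upTo⁺ (s≤s x≤s∸t)) (subst (ℤ.+ 0 ℤ.≤_) (≡-sym α≡M) (ℤ.+≤+ z≤n)))
    where
    e : ∀ t M xx ox → t + M + xx + ox ≡ t + (xx + (M + ox))
    e = solve-∀
    -- The list behind `Iₙ` stops at `s ∸ t`; x ≤ x² keeps `x` within it.
    x≤s∸t : x ≤ s ∸ t
    x≤s∸t = ≤-trans (x≤x*x x) (≤-trans (m≤m+n (x * x) (M + o * x))
      (≤-reflexive (≡-sym (trans (cong (_∸ t) (trans s≡ (e t M (x * x) (o * x)))) (m+n∸m≡n t _)))))

  module _ {b : ℕ} (b+x≡f : b + x ≡ f) where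

    private
      ≤-shift : ∀ u k v → u ≤ v + k → ℤ.+ u ℤ.- ℤ.+ k ℤ.≤ ℤ.+ v
      ≤-shift u k v le = ℤ.≤-trans (ℤ.+-monoˡ-≤ (ℤ.- ℤ.+ k) (ℤ.+≤+ le))
        (ℤ.≤-reflexive (trans (cong (ℤ._- ℤ.+ k) (ℤ.pos-+ v k)) (e (ℤ.+ v) (ℤ.+ k))))
        where
        e : ∀ v k → v ℤ.+ k ℤ.- k ≡ v
        e = ℤ-Solver.solve-∀

    T₃G₂-≤ : ∀ {T} → s * b ≤ T + M → T₃G₂ s t n ℤ.≤ ℤ.+ T
    T₃G₂-≤ {T} le = ℤ.≤-trans (minOverI-≤ _) (ℤ.≤-trans (ℤ.≤-reflexive value) (≤-shift (s * b) M T le))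
      where
      e : ∀ s b x M → s ℤ.* (b ℤ.+ x ℤ.- x) ℤ.- M ≡ s ℤ.* b ℤ.- M
      e = ℤ-Solver.solve-∀
      value : ℤ.+ s ℤ.* (floor2 n ℤ.- ℤ.+ x) ℤ.- α s t n x ≡ ℤ.+ (s * b) ℤ.- ℤ.+ M
      value = trans (cong₂ (λ u v → ℤ.+ s ℤ.* (ℤ.+ u ℤ.- ℤ.+ x) ℤ.- v) (trans floor≡ (≡-sym b+x≡f)) α≡M)
                    (trans (e (ℤ.+ s) (ℤ.+ b) (ℤ.+ x) (ℤ.+ M)) (cong (ℤ._- ℤ.+ M) (≡-sym (ℤ.pos-* s b))))

    -- The value at `x` is (s - 1)b + a - 2M, where a = `f + o + x` is the larger part; the
    -- subtracted terms move to the other side to stay in the naturals.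
    T₃G₁-≤ : ∀ {T} → s * b + (f + o + x) ≤ T + 2 * M + b → T₃G₁ s t n ℤ.≤ ℤ.+ T
    T₃G₁-≤ {T} le = ℤ.≤-trans (minOverI-≤ _) (ℤ.≤-trans (ℤ.≤-reflexive value)
      (≤-shift (s * b + (f + o + x)) (2 * M + b) T (≤-trans le (≤-reflexive (+-assoc T (2 * M) b)))))
      where
      e : ∀ s b x M a → (s ℤ.- ℤ.+ 1) ℤ.* (b ℤ.+ x ℤ.- x) ℤ.+ a ℤ.- ℤ.+ 2 ℤ.* M ≡
          s ℤ.* b ℤ.+ a ℤ.- (ℤ.+ 2 ℤ.* M ℤ.+ b)
      e = ℤ-Solver.solve-∀
      value : ((ℤ.+ s ℤ.- ℤ.+ 1) ℤ.* (floor2 n ℤ.- ℤ.+ x) ℤ.+ (ceil2 n ℤ.+ ℤ.+ x)) ℤ.- ℤ.+ 2 ℤ.* α s t n x ≡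
              ℤ.+ (s * b + (f + o + x)) ℤ.- ℤ.+ (2 * M + b)
      value = trans (cong₂ (λ u v → (ℤ.+ s ℤ.- ℤ.+ 1) ℤ.* (ℤ.+ u ℤ.- ℤ.+ x) ℤ.+ (ceil2 n ℤ.+ ℤ.+ x) ℤ.- ℤ.+ 2 ℤ.* v)
                           (trans floor≡ (≡-sym b+x≡f)) α≡M)
             (trans (cong (λ u → (ℤ.+ s ℤ.- ℤ.+ 1) ℤ.* (ℤ.+ (b + x) ℤ.- ℤ.+ x) ℤ.+ (ℤ.+ u ℤ.+ ℤ.+ x) ℤ.- ℤ.+ 2 ℤ.* ℤ.+ M) ceil≡)
             (trans (e (ℤ.+ s) (ℤ.+ b) (ℤ.+ x) (ℤ.+ M) (ℤ.+ (f + o + x)))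
                    (cong₂ (λ u v → u ℤ.+ ℤ.+ (f + o + x) ℤ.- (v ℤ.+ ℤ.+ b)) (≡-sym (ℤ.pos-* s b)) (≡-sym (ℤ.pos-* 2 M)))))

-- Comparing e = m + ab − M with e = ⌊n²/4⌋ + t, where ab = ⌊n²/4⌋ − x² − o x.
part-sizes : ∀ {a b f o m M t} → o ≤ 1 → b ≤ a → a + b ≡ 2 * f + o → f * f + o * f + t + M ≡ m + a * b →
  ∃ λ x → b + x ≡ f × a ≡ f + o + x × m ≡ t + M + x * x + o * x
part-sizes {a} {b} {f} {o} {m} {M} {t} o≤1 b≤a a+b≡ e≡ with m≤n⇒∃[o]m+o≡n b≤f
  where
  b≤f : b ≤ f
  -- Otherwise each part has at least `suc f` vertices, and together they exceed `2 * f + o`.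
  b≤f = ≮⇒≥ λ f<b → <⇒≱ (≤-<-trans (+-monoʳ-≤ (2 * f) o≤1) (<-≤-trans (≤-reflexive (e f)) (+-mono-≤ (≤-trans f<b b≤a) f<b))) (≤-reflexive a+b≡)
    where
    e : ∀ f → suc (2 * f + 1) ≡ suc f + suc f
    e = solve-∀
... | x , refl = x , refl , a≡ , +-cancelʳ-≡ (a * b) m _ (trans (≡-sym e≡) (trans (e₂ b x o t M) (cong (λ y → t + M + x * x + o * x + y * b) (≡-sym a≡))))
  where
  e₁ : ∀ b x o → 2 * (b + x) + o ≡ (b + x + o + x) + b
  e₁ = solve-∀
  e₂ : ∀ b x o t M → (b + x) * (b + x) + o * (b + x) + t + M ≡ t + M + x * x + o * x + (b + x + o + x) * b
  e₂ = solve-∀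
  a≡ : a ≡ b + x + o + x
  a≡ = +-cancelʳ-≡ b a _ (trans a+b≡ (e₁ b x o))

-- Graphs with fewer than s⌊n/2⌋ triangles.

module _ {s t n f o : ℕ} (h : Halves n f o) (t>0 : 0 < t) (G : Graph n)
         (e≡ : edgeCount G ≡ (n * n) / 4 + t) (τ≥s : TriangleCoverNumberAtLeast G s)
         (few : triangleCount G < s * f) where

  open Halves h
  open Counting G

  private
    T : ℕ
    T = triangleCount G

  module _ (c : Fin n → Bool) where

    open Bipartition G c

    -- `K` bounds the inner edges independently of `n`. The error `5 * (K * K)` is then at most `f`,
    -- which pins their number down to `s`.
    from-bipartition : ∀ {K} → b ≤ a → ∑² I ≤ 2 * K → 5 * (K * K) ≤ f →
      T₃G₁ s t n ℤ.⊓ T₃G₂ s t n ℤ.≤ ℤ.+ T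
    from-bipartition {K} b≤a ∑²I≤2K large
      with x , b+x≡f , a≡ , m≡ ← part-sizes {m = innerEdges} {M = missing} {t = t} o≤1 b≤a (trans a+b≡n n≡2f+o)
             (trans (cong (λ y → y + missing) (≡-sym (trans e≡ (cong (_+ t) square≡)))) edges+missing)
      = conclude
      where
      m M : ℕ
      m = innerEdges
      M = missing
      open ≤-Reasoning

      m≤K : m ≤ K
      m≤K = *-cancelˡ-≤ 2 (≤-trans (≤-reflexive (≡-sym ∑²I≡)) ∑²I≤2K)

      x≤m : x ≤ m
      x≤m = begin
        x                          ≤⟨ x≤x*x x ⟩
        x * x                      ≤⟨ m≤n+m _ (t + M) ⟩
        t + M + x * x              ≤⟨ m≤m+n _ (o * x) ⟩
        t + M + x * x + o * x      ≡⟨ ≡-sym m≡ ⟩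
        m                          ∎

      M≤m : M ≤ m
      M≤m = begin
        M                          ≤⟨ m≤n+m M t ⟩
        t + M                      ≤⟨ m≤m+n _ (x * x) ⟩
        t + M + x * x              ≤⟨ m≤m+n _ (o * x) ⟩
        t + M + x * x + o * x      ≡⟨ ≡-sym m≡ ⟩
        m                          ∎

      -- The missing pairs cost at most 4m · M, by the crude degree bound 2m for each class, and
      -- replacing `b` by `f` costs m · x. Both `M` and `x` are at most `m`.
      m*f≤ : m * f ≤ T + 5 * (m * m)
      m*f≤ = begin
        m * f                                      ≡⟨ cong (m *_) (≡-sym b+x≡f) ⟩
        m * (b + x)                                ≡⟨ *-distribˡ-+ m b x ⟩
        m * b + m * x                              ≡⟨ cong (λ y → y * b + m * x) (≡-sym P+Q-edges) ⟩
        (P.edges + Q.edges) * b + m * x            ≡⟨ cong (λ y → y + m * x) (*-distribʳ-+ b P.edges Q.edges) ⟩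
        P.edges * b + Q.edges * b + m * x          ≤⟨ +-monoˡ-≤ (m * x) (+-monoʳ-≤ (P.edges * b) (*-monoʳ-≤ Q.edges b≤a)) ⟩
        P.edges * b + Q.edges * a + m * x          ≤⟨ +-monoˡ-≤ (m * x) (triangles-bound (2 * m) (2 * m) (P-inside≤ innerDeg≤) (Q-inside≤ innerDeg≤)) ⟩
        T + (2 * m + 2 * m) * M + m * x            ≤⟨ +-mono-≤ (+-monoʳ-≤ T (*-monoʳ-≤ (2 * m + 2 * m) M≤m)) (*-monoʳ-≤ m x≤m) ⟩
        T + (2 * m + 2 * m) * m + m * m            ≡⟨ e T m ⟩
        T + 5 * (m * m)                            ∎
        where
        e : ∀ T m → T + (2 * m + 2 * m) * m + m * m ≡ T + 5 * (m * m)
        e = solve-∀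

      m≤s : m ≤ s
      -- With more than `s` inner edges, (s + 1)f ≤ T + 5K² ≤ T + f, so s f ≤ T, against `few`.
      m≤s = ≮⇒≥ λ s<m → <⇒≱ (+-monoˡ-< f few) (begin
        s * f + f                                  ≡⟨ +-comm (s * f) f ⟩
        suc s * f                                  ≤⟨ *-monoˡ-≤ f s<m ⟩
        m * f                                      ≤⟨ m*f≤ ⟩
        T + 5 * (m * m)                            ≤⟨ +-monoʳ-≤ T (*-monoʳ-≤ 5 (*-mono-≤ m≤K m≤K)) ⟩
        T + 5 * (K * K)                            ≤⟨ +-monoʳ-≤ T large ⟩
        T + f                                      ∎)

      m≡s : m ≡ s
      m≡s = ≤-antisym m≤s (s≤innerEdges τ≥s)

      innerDeg≤1 : ∀ k → innerDeg k ≤ 1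
      -- With no inner edge in excess of `s`, the cover bound leaves room for only one at `k`: the
      -- inner edges form a matching.
      innerDeg≤1 k = +-cancelˡ-≤ s _ _ (≤-trans (s+innerDeg≤ τ≥s k) (≤-trans (s≤s m≤s) (≤-reflexive (+-comm 1 s))))

      open Target {s} {t} {n} h {x} {M} (trans (≡-sym m≡s) m≡)

      P+Q≡s : P.edges + Q.edges ≡ s
      P+Q≡s = trans P+Q-edges m≡s

      s*b≤ : s * b ≤ P.edges * b + Q.edges * a
      s*b≤ = begin
        s * b                             ≡⟨ cong (_* b) (≡-sym P+Q≡s) ⟩
        (P.edges + Q.edges) * b           ≡⟨ *-distribʳ-+ b P.edges Q.edges ⟩
        P.edges * b + Q.edges * b         ≤⟨ +-monoʳ-≤ (P.edges * b) (*-monoʳ-≤ Q.edges b≤a) ⟩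
        P.edges * b + Q.edges * a         ∎

      ≤0 : ∀ {y z} w → y ≤ 2 * z → z ≡ 0 → y ≤ w * 0
      ≤0 w y≤ refl = ≤-trans y≤ z≤n

      viaG₂ : P.edges * b + Q.edges * a ≤ T + 1 * M → T₃G₁ s t n ℤ.⊓ T₃G₂ s t n ℤ.≤ ℤ.+ T
      viaG₂ le = ℤ.≤-trans (ℤ.i⊓j≤j _ _)
        (T₃G₂-≤ b+x≡f (≤-trans s*b≤ (≤-trans le (≤-reflexive (cong (T +_) (*-identityˡ M))))))

      -- Edges counted by `Q` lie in the smaller class and have their apexes in the larger one. One
      -- of them keeps the factor `a`, like the edge inside B in G₁; the others are lowered to `b`.
      s*b+a≤ : ∀ z → Q.edges ≡ suc z → s * b + a ≤ P.edges * b + Q.edges * a + b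
      s*b+a≤ z Q≡ = begin
        s * b + a                            ≡⟨ cong (λ y → y * b + a) (≡-sym (trans (cong (P.edges +_) (≡-sym Q≡)) P+Q≡s)) ⟩
        (P.edges + suc z) * b + a            ≡⟨ e₁ P.edges z b a ⟩
        P.edges * b + (a + z * b) + b        ≤⟨ +-monoˡ-≤ b (+-monoʳ-≤ (P.edges * b) (+-monoʳ-≤ a (*-monoʳ-≤ z b≤a))) ⟩
        P.edges * b + suc z * a + b          ≡⟨ cong (λ y → P.edges * b + y * a + b) (≡-sym Q≡) ⟩
        P.edges * b + Q.edges * a + b        ∎
        where
        e₁ : ∀ y z b a → (y + suc z) * b + a ≡ y * b + (a + z * b) + b
        e₁ = solve-∀

      cases : ∀ y z → P.edges ≡ y → Q.edges ≡ z → T₃G₁ s t n ℤ.⊓ T₃G₂ s t n ℤ.≤ ℤ.+ T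
      -- All inner edges lie in one class, so a missing pair spoils triangles only through its end
      -- there.
      cases _ zero _ Q≡0 =
        viaG₂ (triangles-bound 1 0 (P-inside≤ innerDeg≤1) (λ k → ≤0 (q k) (Q.∑inside≤ k) Q≡0))
      cases zero (suc _) P≡0 _ =
        viaG₂ (triangles-bound 0 1 (λ k → ≤0 (p k) (P.∑inside≤ k) P≡0) (Q-inside≤ innerDeg≤1))
      -- With inner edges in both classes, a missing pair may spoil one triangle at each end, whence
      -- 2M.
      cases (suc _) (suc z) _ Q≡ = ℤ.≤-trans (ℤ.i⊓j≤i _ _) (T₃G₁-≤ b+x≡f (begin
        s * b + (f + o + x)                  ≡⟨ cong (s * b +_) (≡-sym a≡) ⟩
        s * b + a                            ≤⟨ s*b+a≤ z Q≡ ⟩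
        P.edges * b + Q.edges * a + b        ≤⟨ +-monoˡ-≤ b (triangles-bound 1 1 (P-inside≤ innerDeg≤1) (Q-inside≤ innerDeg≤1)) ⟩
        T + 2 * M + b                        ∎))

      conclude : T₃G₁ s t n ℤ.⊓ T₃G₂ s t n ℤ.≤ ℤ.+ T
      conclude = cases P.edges Q.edges refl refl

  -- For odd `n`, n² exceeds 4⌊n²/4⌋ by one, which the surplus of `t` ≥ 1 edges absorbs.
  nn≤2∑²A : n * n ≤ 2 * ∑² A
  nn≤2∑²A = begin
    n * n                                    ≡⟨ cong₂ _*_ n≡2f+o n≡2f+o ⟩
    (2 * f + o) * (2 * f + o)                ≡⟨ e₁ f o ⟩
    4 * (f * f + o * f) + o * o              ≤⟨ +-monoʳ-≤ (4 * (f * f + o * f)) (*-mono-≤ o≤1 o≤1) ⟩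
    4 * (f * f + o * f) + 1                  ≤⟨ +-monoʳ-≤ (4 * (f * f + o * f)) (*-mono-≤ {1} {4} (s≤s z≤n) t>0) ⟩
    4 * (f * f + o * f) + 4 * t              ≡⟨ e₂ (f * f + o * f) t ⟩
    2 * (2 * (f * f + o * f + t))            ≡⟨ cong (λ y → 2 * (2 * y)) (≡-sym (trans e≡ (cong (_+ t) square≡))) ⟩
    2 * (2 * edgeCount G)                    ≡⟨ cong (2 *_) (≡-sym ∑²A≡2e) ⟩
    2 * ∑² A                                 ∎
    where
    open ≤-Reasoning
    e₁ : ∀ f o → (2 * f + o) * (2 * f + o) ≡ 4 * (f * f + o * f) + o * o
    e₁ = solve-∀
    e₂ : ∀ y t → 4 * y + 4 * t ≡ 2 * (2 * (y + t))
    e₂ = solve-∀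

  -- From `∑³ tri` ≤ 6T and T ≤ s f follows 4n · `∑³ tri` ≤ 12s · n² ≤ 24s · `∑² A`; since `∑² A` is
  -- positive, the bound becomes strict. The constant is kept as 2 · 12s because it bounds ordered
  -- pairs, that is, 12s inner edges.
  4n∑³tri< : 4 * n * ∑³ tri < ∑² A * suc (2 * (12 * s))
  4n∑³tri< = begin-strict
    4 * n * ∑³ tri                 ≤⟨ *-monoʳ-≤ (4 * n) ∑³tri≤6T ⟩
    4 * n * (6 * T)                ≤⟨ *-monoʳ-≤ (4 * n) (*-monoʳ-≤ 6 (<⇒≤ few)) ⟩
    4 * n * (6 * (s * f))          ≡⟨ e₁ n s f ⟩
    12 * s * (n * (2 * f))         ≤⟨ *-monoʳ-≤ (12 * s) (*-monoʳ-≤ n (≤-trans (m≤m+n (2 * f) o) (≤-reflexive (≡-sym n≡2f+o)))) ⟩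
    12 * s * (n * n)               ≤⟨ *-monoʳ-≤ (12 * s) nn≤2∑²A ⟩
    12 * s * (2 * ∑² A)            ≡⟨ e₂ (12 * s) (∑² A) ⟩
    0 + ∑² A * (2 * (12 * s))      <⟨ +-monoˡ-< (∑² A * (2 * (12 * s))) E>0 ⟩
    ∑² A + ∑² A * (2 * (12 * s))   ≡⟨ ≡-sym (*-suc (∑² A) (2 * (12 * s))) ⟩
    ∑² A * suc (2 * (12 * s))            ∎
    where
    open ≤-Reasoning
    e₁ : ∀ n s f → 4 * n * (6 * (s * f)) ≡ 12 * s * (n * (2 * f))
    e₁ = solve-∀
    e₂ : ∀ K E → K * (2 * E) ≡ 0 + E * (2 * K)
    e₂ = solve-∀
    E>0 : 0 < ∑² A
    E>0 = begin-strict
      0                  <⟨ t>0 ⟩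
      t                  ≤⟨ m≤n+m t _ ⟩
      (n * n) / 4 + t    ≡⟨ ≡-sym e≡ ⟩
      edgeCount G        ≤⟨ m≤m+n _ _ ⟩
      2 * edgeCount G    ≡⟨ ≡-sym ∑²A≡2e ⟩
      ∑² A               ∎

  few-triangles : 2 * (12 * s) < n → 5 * (12 * s * (12 * s)) ≤ f → T₃G₁ s t n ℤ.⊓ T₃G₂ s t n ℤ.≤ ℤ.+ T
  few-triangles 2K<n large = split-along (light-edge (2 * (12 * s)) (Z≤∑³tri nn≤2∑²A) 4n∑³tri<)
    where
    orient : ∀ c → ∑² (λ k l → ind (inner c k l)) ≤ 2 * (12 * s) →
             Bipartition.b G c ≤ Bipartition.a G c ⊎ Bipartition.a G c ≤ Bipartition.b G c →
             T₃G₁ s t n ℤ.⊓ T₃G₂ s t n ℤ.≤ ℤ.+ T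
    orient c ∑²I≤2K (inj₁ b≤a) = from-bipartition c {12 * s} b≤a ∑²I≤2K large
    orient c ∑²I≤2K (inj₂ a≤b) = from-bipartition (not ∘ c) {12 * s}
      (≤-trans (≤-reflexive (∑-cong (λ k → cong ind (not-involutive (c k))))) a≤b)
      (≤-trans (≤-reflexive (∑²-cong (λ k l → cong (λ y → ind (not y ∧ Adj G k l)) (xor-not (c k) (c l))))) ∑²I≤2K) large
      where
      xor-not : ∀ x y → not x xor not y ≡ x xor y
      xor-not true  y = refl
      xor-not false y = not-involutive y

    split-along : (∃₂ λ i j → Adj G i j ≡ true × defect i j ≤ 2 * (12 * s)) →
                  T₃G₁ s t n ℤ.⊓ T₃G₂ s t n ℤ.≤ ℤ.+ T
    split-along (i , j , _ , df≤2K) =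
      orient (Adj G i) (≤-trans (near-bipartition i j (≤-<-trans df≤2K 2K<n)) df≤2K) (≤-total _ _)

-- The choice of n₀ and the final case distinction.

open import Data.Integer using (+_; _⊓_) renaming (_≤_ to _≤ℤ_)

theorem1p2 : (s t : ℕ) → 0 < t → t < s →
    ∃ λ n₀ → (n : ℕ) → n₀ ≤ n → (G : Graph n) →
    edgeCount G ≡ (n * n) / 4 + t →
    TriangleCoverNumberAtLeast G s →
    (T₃G₁ s t n ⊓ T₃G₂ s t n) ≤ℤ + (triangleCount G)
theorem1p2 s t 0<t t<s = suc (2 * K) + 2 * (5 * (K * K)) , λ n n₀≤n G e≡ τ≥s → bound n n₀≤n G e≡ τ≥s (halves n)
  where
  -- The threshold exceeds 2K, which puts the defect of the light edge below `n`; its other summand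
  -- 10K² ensures 5K² ≤ ⌊n/2⌋.
  K : ℕ
  K = 12 * s

  module _ {n f o : ℕ} (h : Halves n f o) where

    s≡ : s ≡ t + (s ∸ t) + 0 * 0 + o * 0
    s≡ = trans (≡-sym (m+[n∸m]≡n (<⇒≤ t<s))) (e _ o)
      where
      e : ∀ x o → x ≡ x + 0 * 0 + o * 0
      e = solve-∀

    5KK≤f : suc (2 * K) + 2 * (5 * (K * K)) ≤ n → 5 * (K * K) ≤ f
    5KK≤f n₀≤n = *-cancelˡ-≤ 2 (+-cancelˡ-≤ 1 _ _ (begin
      1 + 2 * (5 * (K * K))              ≤⟨ s≤s (m≤n+m (2 * (5 * (K * K))) (2 * K)) ⟩
      suc (2 * K) + 2 * (5 * (K * K))    ≤⟨ n₀≤n ⟩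
      n                                  ≡⟨ Halves.n≡2f+o h ⟩
      2 * f + o                          ≤⟨ +-monoʳ-≤ (2 * f) (Halves.o≤1 h) ⟩
      2 * f + 1                          ≡⟨ +-comm (2 * f) 1 ⟩
      1 + 2 * f                          ∎))
      where open ≤-Reasoning

  bound : (n : ℕ) → suc (2 * K) + 2 * (5 * (K * K)) ≤ n → (G : Graph n) → edgeCount G ≡ (n * n) / 4 + t →
          TriangleCoverNumberAtLeast G s → ∃₂ (Halves n) → (T₃G₁ s t n ⊓ T₃G₂ s t n) ≤ℤ + (triangleCount G)
  bound n n₀≤n G e≡ τ≥s (f , o , h) = by-cases (<-≤-connex (triangleCount G) (s * f))
    where
    by-cases : triangleCount G < s * f ⊎ s * f ≤ triangleCount G →
               (T₃G₁ s t n ⊓ T₃G₂ s t n) ≤ℤ + (triangleCount G)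
    by-cases (inj₁ few)  = few-triangles h 0<t G e≡ τ≥s few (≤-trans (m≤m+n _ _) n₀≤n) (5KK≤f h n₀≤n)
    -- Comparison with G₂ at a = 0, where α is `s ∸ t` and the value is at most s⌊n/2⌋.
    by-cases (inj₂ many) = ℤ.≤-trans (ℤ.i⊓j≤j _ _)
      (Target.T₃G₂-≤ h {0} {s ∸ t} (s≡ h) (+-identityʳ f) (≤-trans many (m≤m+n _ _)))
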